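{- Let $K$ be a subfield of $\mathbb{C}$. Let $T$ be a tensor of format $n\times n\times p$ over $K$. Assume moreover that the span of the $z$-slices of $T$ contains an invertible matrix. For any integer $r\ge n$, $\operatorname{rank}(T)\le r$ if and only if there is a tensor $S\in K^{r\times r\times p}$ with $z$-slices $Z_1,\ldots,Z_p$ such that: (i) The span of $Z_1,\ldots,Z_p$ contains an invertible matrix. (ii) For any invertible matrix $Z$ in the span of $Z_1,\ldots,Z_p$, the matrices $Z^{ -1}Z_i$ ($1\le i\le p$) pairwise commute and are diagonalizable over $K$. (iii) $T$ is a subtensor of $S$ in the sense that $T_{ijk}=S_{ijk}$ for $1\le i,j\le n$ and $1\le k\le p$.
   Context: A tensor of format $m\times n\times p$ over a field $K$ is an array $T=(T_{ijk})\in K^{m\times n\times p}$. Its $k$-th $z$-slice is the $m\times n$ matrix $(T_{ijk})_{i,j}$, for $1\le k\le p$. Spans are over $K$. For $u\in K^m$, $v\in K^n$, $w\in K^p$, the tensor $u\otimes v\otimes w$ has entries $u_iv_jw_k$; it has rank one if $u,v,w\neq 0$. The rank over $K$, $\operatorname{rank}(T)$, is the smallest $r$ such that $T$ is a sum of $r$ rank-one tensors over $K$ (with $\operatorname{rank}(0)=0$). -}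

module Defs where

open import Algebra.Bundles using (CommutativeRing)
open import Algebra.Morphism.Structures using (IsRingMonomorphism)
import Algebra.Morphism.RingMonomorphism as RingMonomorphism
import Algebra.Properties.CommutativeMonoid.Sum as Sum
import Algebra.Properties.Ring as RingProperties
import Algebra.Solver.Ring.NaturalCoefficients.Default as Solver
open import Data.Bool.Base using (if_then_else_)
open import Data.Fin.Base using (Fin; inject≤)
open import Data.Fin.Properties using (_≟_)
open import Data.Nat.Base as ℕ using (ℕ)
import Data.Nat.Properties as ℕ
open import Data.Product.Base using (Σ; Σ-syntax; ∃-syntax; _×_; _,_; proj₁; proj₂)
open import Data.Rational.Base as ℚ using (ℚ; 0ℚ; 1ℚ; ½)
import Data.Rational.Properties as ℚ
open import Data.Rational.Solver using (module +-*-Solver)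
open import Level using (Level; 0ℓ; _⊔_; suc)
open import Relation.Binary.PropositionalEquality as ≡ using (_≡_)
open import Relation.Nullary using (¬_; does)

private variable
  c ℓ : Level

-- ℝ is the setoid of Cauchy sequences of rationals modulo null sequences

module Reals where
  open import Data.Rational.Base using (_+_; _*_; -_; _-_; _<_; ∣_∣; 1/_; Positive)

  IsCauchy : (ℕ → ℚ) → Set
  IsCauchy x = ∀ ε → 0ℚ < ε → ∃[ N ] ∀ m n → N ℕ.≤ m → N ℕ.≤ n → ∣ x m - x n ∣ < ε

  record ℝ : Set where
    constructor mkℝ
    field
      seq    : ℕ → ℚ
      cauchy : IsCauchy seq

  open ℝ public

  infix 4 _≈ℝ_

  -- A record rather than a function, so that the two reals can be inferred.
  record _≈ℝ_ (x y : ℝ) : Set where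
    constructor mk≈
    field
      close : ∀ ε → 0ℚ < ε → ∃[ N ] ∀ n → N ℕ.≤ n → ∣ seq x n - seq y n ∣ < ε

  open _≈ℝ_ public

  private
    module _ where
      open +-*-Solver

      half+half : ∀ ε → ½ * ε + ½ * ε ≡ ε
      half+half = solve 1 (λ e → con ½ :* e :+ con ½ :* e := e) ≡.refl

      sum-split : ∀ a b c d → (a + b) - (c + d) ≡ (a - c) + (b - d)
      sum-split = solve 4 (λ a b c d → (a :+ b) :- (c :+ d) := (a :- c) :+ (b :- d)) ≡.refl

      prod-split : ∀ a b c d → a * b - c * d ≡ a * (b - d) + (a - c) * d
      prod-split = solve 4 (λ a b c d →
        a :* b :- c :* d := a :* (b :- d) :+ (a :- c) :* d) ≡.refl

      via-split : ∀ a b c → a - c ≡ (a - b) + (b - c)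
      via-split = solve 3 (λ a b c → a :- c := (a :- b) :+ (b :- c)) ≡.refl

      restore : ∀ a b → a ≡ (a - b) + b
      restore = solve 2 (λ a b → a := (a :- b) :+ b) ≡.refl

      neg-split : ∀ a b → (- a) - (- b) ≡ - (a - b)
      neg-split = solve 2 (λ a b → (:- a) :- (:- b) := :- (a :- b)) ≡.refl

      swap-sub : ∀ a b → b - a ≡ - (a - b)
      swap-sub = solve 2 (λ a b → b :- a := :- (a :- b)) ≡.refl

    abstract
      half-pos : ∀ {ε} → 0ℚ < ε → 0ℚ < ½ * ε
      half-pos {ε} 0<ε = ℚ.positive⁻¹ (½ * ε) {{ℚ.pos*pos⇒pos ½ ε {{ℚ.positive 0<ε}}}}

      ∣p-p∣<ε : ∀ p {ε} → 0ℚ < ε → ∣ p - p ∣ < ε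
      ∣p-p∣<ε p 0<ε = ≡.subst (_< _) (≡.sym (≡.cong ∣_∣ (ℚ.+-inverseʳ p))) 0<ε

      add-small : ∀ a b ε → ∣ a ∣ < ½ * ε → ∣ b ∣ < ½ * ε → ∣ a + b ∣ < ε
      add-small a b ε a< b< = ≡.subst (∣ a + b ∣ <_) (half+half ε)
        (ℚ.≤-<-trans (ℚ.∣p+q∣≤∣p∣+∣q∣ a b) (ℚ.+-mono-< a< b<))

      neg-small : ∀ a {ε} → ∣ a ∣ < ε → ∣ - a ∣ < ε
      neg-small a = ≡.subst (_< _) (≡.sym (ℚ.∣-p∣≡∣p∣ a))

      scale : ∀ B .{{_ : Positive B}} → ℚ → ℚ
      scale B ε = (1/ B) {{ℚ.pos⇒nonZero B}} * (½ * ε)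

      scale-pos : ∀ B .{{_ : Positive B}} {ε} → 0ℚ < ε → 0ℚ < scale B ε
      scale-pos B {ε} 0<ε = ℚ.positive⁻¹ (scale B ε)
        {{ℚ.pos*pos⇒pos ((1/ B) {{ℚ.pos⇒nonZero B}}) {{ℚ.1/pos⇒pos B}}
                        (½ * ε) {{ℚ.positive (half-pos 0<ε)}}}}

      scale-* : ∀ B .{{_ : Positive B}} ε → B * scale B ε ≡ ½ * ε
      scale-* B ε = ≡.trans (≡.sym (ℚ.*-assoc B ((1/ B) {{B≢0}}) (½ * ε)))
        (≡.trans (≡.cong (_* (½ * ε)) (ℚ.*-inverseʳ B {{B≢0}})) (ℚ.*-identityˡ (½ * ε)))
        where
        B≢0 : ℚ.NonZero B
        B≢0 = ℚ.pos⇒nonZero B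

      mul-small : ∀ a b B .{{_ : Positive B}} ε →
                  ∣ a ∣ < B → ∣ b ∣ < scale B ε → ∣ a * b ∣ < ½ * ε
      mul-small a b B ε a< b< = begin-strict
        ∣ a * b ∣       ≡⟨ ℚ.∣p*q∣≡∣p∣*∣q∣ a b ⟩
        ∣ a ∣ * ∣ b ∣   ≤⟨ ℚ.*-monoʳ-≤-nonNeg ∣ b ∣ {{ℚ.∣-∣-nonNeg b}} (ℚ.<⇒≤ a<) ⟩
        B * ∣ b ∣       <⟨ ℚ.*-monoʳ-<-pos B b< ⟩
        B * scale B ε   ≡⟨ scale-* B ε ⟩
        ½ * ε           ∎
        where open ℚ.≤-Reasoning

      mul-close : ∀ a b a′ b′ A B .{{_ : Positive A}} .{{_ : Positive B}} ε →
                  ∣ a ∣ < A → ∣ b′ ∣ < B → ∣ a - a′ ∣ < scale B ε → ∣ b - b′ ∣ < scale A ε →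
                  ∣ a * b - a′ * b′ ∣ < ε
      mul-close a b a′ b′ A B ε a< b′< a-a′< b-b′< =
        ≡.subst (λ t → ∣ t ∣ < ε) (≡.sym (prod-split a b a′ b′))
          (add-small (a * (b - b′)) ((a - a′) * b′) ε
            (mul-small a (b - b′) A ε a< b-b′<)
            (≡.subst (λ t → ∣ t ∣ < ½ * ε) (ℚ.*-comm b′ (a - a′))
              (mul-small b′ (a - a′) B ε b′< a-a′<)))

    record EventualBound (x : ℕ → ℚ) : Set where
      field
        bound     : ℚ
        start     : ℕ
        bound-pos : Positive bound
        bounded   : ∀ n → start ℕ.≤ n → ∣ x n ∣ < bound

    abstract
      eventualBound : ∀ x → IsCauchy x → EventualBound x
      eventualBound x cx with cx 1ℚ (ℚ.positive⁻¹ 1ℚ)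
      ... | N , small = record
        { bound     = 1ℚ + ∣ x N ∣
        ; start     = N
        ; bound-pos = ℚ.pos+nonNeg⇒pos 1ℚ ∣ x N ∣ {{ℚ.∣-∣-nonNeg (x N)}}
        ; bounded   = λ n N≤n → ≡.subst (λ t → ∣ t ∣ < 1ℚ + ∣ x N ∣) (≡.sym (restore (x n) (x N)))
            (ℚ.≤-<-trans (ℚ.∣p+q∣≤∣p∣+∣q∣ (x n - x N) (x N))
              (ℚ.+-mono-<-≤ (small n N N≤n ℕ.≤-refl) ℚ.≤-refl))
        }

      ⊔ˡ : ∀ {m} n {k} → m ℕ.⊔ n ℕ.≤ k → m ℕ.≤ k
      ⊔ˡ n = ℕ.≤-trans (ℕ.m≤m⊔n _ n)

      ⊔ʳ : ∀ m {n k} → m ℕ.⊔ n ℕ.≤ k → n ℕ.≤ k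
      ⊔ʳ m = ℕ.≤-trans (ℕ.m≤n⊔m m _)

      pointwise : ∀ x y → (∀ n → seq x n ≡ seq y n) → x ≈ℝ y
      pointwise x y eq = mk≈ λ ε 0<ε → 0 , λ n _ →
        ≡.subst (λ t → ∣ t - seq y n ∣ < ε) (≡.sym (eq n)) (∣p-p∣<ε (seq y n) 0<ε)

  fromℚ : ℚ → ℝ
  fromℚ q = mkℝ (λ _ → q) (λ ε 0<ε → 0 , λ _ _ _ _ → ∣p-p∣<ε q 0<ε)

  infixl 6 _+ℝ_
  infixl 7 _*ℝ_
  infix  8 -ℝ_

  private abstract
    +-cauchy : ∀ x y → IsCauchy x → IsCauchy y → IsCauchy (λ n → x n + y n)
    +-cauchy x y cx cy ε 0<ε with cx (½ * ε) (half-pos 0<ε) | cy (½ * ε) (half-pos 0<ε)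
    ... | M , xs | N , ys = M ℕ.⊔ N , λ m n ≤m ≤n →
      ≡.subst (λ t → ∣ t ∣ < ε) (≡.sym (sum-split (x m) (y m) (x n) (y n)))
        (add-small (x m - x n) (y m - y n) ε
          (xs m n (⊔ˡ N ≤m) (⊔ˡ N ≤n)) (ys m n (⊔ʳ M ≤m) (⊔ʳ M ≤n)))

    neg-cauchy : ∀ x → IsCauchy x → IsCauchy (λ n → - x n)
    neg-cauchy x cx ε 0<ε with cx ε 0<ε
    ... | N , xs = N , λ m n ≤m ≤n →
      ≡.subst (λ t → ∣ t ∣ < ε) (≡.sym (neg-split (x m) (x n)))
        (neg-small (x m - x n) (xs m n ≤m ≤n))

    *-cauchy : ∀ x y → IsCauchy x → IsCauchy y → IsCauchy (λ n → x n * y n)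
    *-cauchy x y cx cy ε 0<ε =
      let M , xs = cx (scale B ε) (scale-pos B 0<ε)
          N , ys = cy (scale A ε) (scale-pos A 0<ε)
      in (M₀ ℕ.⊔ N₀) ℕ.⊔ (M ℕ.⊔ N) , λ m n ≤m ≤n →
        mul-close (x m) (y m) (x n) (y n) A B ε
          (xb m (⊔ˡ N₀ (⊔ˡ (M ℕ.⊔ N) ≤m)))
          (yb n (⊔ʳ M₀ (⊔ˡ (M ℕ.⊔ N) ≤n)))
          (xs m n (⊔ˡ N (⊔ʳ (M₀ ℕ.⊔ N₀) ≤m)) (⊔ˡ N (⊔ʳ (M₀ ℕ.⊔ N₀) ≤n)))
          (ys m n (⊔ʳ M (⊔ʳ (M₀ ℕ.⊔ N₀) ≤m)) (⊔ʳ M (⊔ʳ (M₀ ℕ.⊔ N₀) ≤n)))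
      where
      open EventualBound (eventualBound x cx)
        renaming (bound to A; start to M₀; bounded to xb; bound-pos to A>0)
      open EventualBound (eventualBound y cy)
        renaming (bound to B; start to N₀; bounded to yb; bound-pos to B>0)
      instance
        A⁺ : Positive A
        A⁺ = A>0
        B⁺ : Positive B
        B⁺ = B>0

  _+ℝ_ : ℝ → ℝ → ℝ
  x +ℝ y = mkℝ (λ n → seq x n + seq y n) (+-cauchy (seq x) (seq y) (cauchy x) (cauchy y))

  -ℝ_ : ℝ → ℝ
  -ℝ x = mkℝ (λ n → - seq x n) (neg-cauchy (seq x) (cauchy x))

  _*ℝ_ : ℝ → ℝ → ℝ
  x *ℝ y = mkℝ (λ n → seq x n * seq y n) (*-cauchy (seq x) (seq y) (cauchy x) (cauchy y))

  private abstract
    ≈ℝ-sym : ∀ {x y} → x ≈ℝ y → y ≈ℝ x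
    ≈ℝ-sym {x} {y} (mk≈ p) = mk≈ λ ε 0<ε → let N , f = p ε 0<ε in N , λ n N≤n →
      ≡.subst (λ t → ∣ t ∣ < ε) (≡.sym (swap-sub (seq x n) (seq y n)))
        (neg-small (seq x n - seq y n) (f n N≤n))

    ≈ℝ-trans : ∀ {x y z} → x ≈ℝ y → y ≈ℝ z → x ≈ℝ z
    ≈ℝ-trans {x} {y} {z} (mk≈ p) (mk≈ q) = mk≈ λ ε 0<ε →
      let M , f = p (½ * ε) (half-pos 0<ε)
          N , g = q (½ * ε) (half-pos 0<ε)
      in M ℕ.⊔ N , λ n ≤n →
        ≡.subst (λ t → ∣ t ∣ < ε) (≡.sym (via-split (seq x n) (seq y n) (seq z n)))
          (add-small (seq x n - seq y n) (seq y n - seq z n) ε (f n (⊔ˡ N ≤n)) (g n (⊔ʳ M ≤n)))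

    +ℝ-cong : ∀ {x x′ y y′} → x ≈ℝ x′ → y ≈ℝ y′ → x +ℝ y ≈ℝ x′ +ℝ y′
    +ℝ-cong {x} {x′} {y} {y′} (mk≈ p) (mk≈ q) = mk≈ λ ε 0<ε →
      let M , f = p (½ * ε) (half-pos 0<ε)
          N , g = q (½ * ε) (half-pos 0<ε)
      in M ℕ.⊔ N , λ n ≤n →
        ≡.subst (λ t → ∣ t ∣ < ε) (≡.sym (sum-split (seq x n) (seq y n) (seq x′ n) (seq y′ n)))
          (add-small (seq x n - seq x′ n) (seq y n - seq y′ n) ε (f n (⊔ˡ N ≤n)) (g n (⊔ʳ M ≤n)))

    -ℝ-cong : ∀ {x x′} → x ≈ℝ x′ → -ℝ x ≈ℝ -ℝ x′
    -ℝ-cong {x} {x′} (mk≈ p) = mk≈ λ ε 0<ε → let N , f = p ε 0<ε in N , λ n ≤n →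
      ≡.subst (λ t → ∣ t ∣ < ε) (≡.sym (neg-split (seq x n) (seq x′ n)))
        (neg-small (seq x n - seq x′ n) (f n ≤n))

    *ℝ-cong : ∀ {x x′ y y′} → x ≈ℝ x′ → y ≈ℝ y′ → x *ℝ y ≈ℝ x′ *ℝ y′
    *ℝ-cong {x} {x′} {y} {y′} (mk≈ p) (mk≈ q) = mk≈ λ ε 0<ε →
      let M , f = p (scale B ε) (scale-pos B 0<ε)
          N , g = q (scale A ε) (scale-pos A 0<ε)
      in (M₀ ℕ.⊔ N₀) ℕ.⊔ (M ℕ.⊔ N) , λ n ≤n →
        mul-close (seq x n) (seq y n) (seq x′ n) (seq y′ n) A B ε
          (xb n (⊔ˡ N₀ (⊔ˡ (M ℕ.⊔ N) ≤n))) (yb n (⊔ʳ M₀ (⊔ˡ (M ℕ.⊔ N) ≤n)))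
          (f n (⊔ˡ N (⊔ʳ (M₀ ℕ.⊔ N₀) ≤n))) (g n (⊔ʳ M (⊔ʳ (M₀ ℕ.⊔ N₀) ≤n)))
      where
      open EventualBound (eventualBound (seq x) (cauchy x))
        renaming (bound to A; start to M₀; bounded to xb; bound-pos to A>0)
      open EventualBound (eventualBound (seq y′) (cauchy y′))
        renaming (bound to B; start to N₀; bounded to yb; bound-pos to B>0)
      instance
        A⁺ : Positive A
        A⁺ = A>0
        B⁺ : Positive B
        B⁺ = B>0

  ℝ-commutativeRing : CommutativeRing 0ℓ 0ℓ
  ℝ-commutativeRing = record
    { Carrier = ℝ
    ; _≈_ = _≈ℝ_
    ; _+_ = _+ℝ_
    ; _*_ = _*ℝ_
    ; -_  = -ℝ_
    ; 0#  = fromℚ 0ℚ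
    ; 1#  = fromℚ 1ℚ
    ; isCommutativeRing = record
      { isRing = record
        { +-isAbelianGroup = record
          { isGroup = record
            { isMonoid = record
              { isSemigroup = record
                { isMagma = record
                  { isEquivalence = record
                    { refl  = pointwise _ _ (λ _ → ≡.refl)
                    ; sym   = ≈ℝ-sym
                    ; trans = ≈ℝ-trans
                    }
                  ; ∙-cong = +ℝ-cong
                  }
                ; assoc = λ x y z → pointwise _ _ (λ n → ℚ.+-assoc (seq x n) (seq y n) (seq z n))
                }
              ; identity = (λ x → pointwise _ _ (λ n → ℚ.+-identityˡ (seq x n)))
                         , (λ x → pointwise _ _ (λ n → ℚ.+-identityʳ (seq x n)))
              }
            ; inverse = (λ x → pointwise _ _ (λ n → ℚ.+-inverseˡ (seq x n)))
                      , (λ x → pointwise _ _ (λ n → ℚ.+-inverseʳ (seq x n)))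
            ; ⁻¹-cong = -ℝ-cong
            }
          ; comm = λ x y → pointwise _ _ (λ n → ℚ.+-comm (seq x n) (seq y n))
          }
        ; *-cong = *ℝ-cong
        ; *-assoc = λ x y z → pointwise _ _ (λ n → ℚ.*-assoc (seq x n) (seq y n) (seq z n))
        ; *-identity = (λ x → pointwise _ _ (λ n → ℚ.*-identityˡ (seq x n)))
                     , (λ x → pointwise _ _ (λ n → ℚ.*-identityʳ (seq x n)))
        ; distrib = (λ x y z → pointwise _ _ (λ n → ℚ.*-distribˡ-+ (seq x n) (seq y n) (seq z n)))
                  , (λ x y z → pointwise _ _ (λ n → ℚ.*-distribʳ-+ (seq x n) (seq y n) (seq z n)))
        }
      ; *-comm = λ x y → pointwise _ _ (λ n → ℚ.*-comm (seq x n) (seq y n))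
      }
    }

open Reals public

-- R[i] = R[X]/(X² + 1); the pair (a , b) stands for a + b i.
module Gaussian (R : CommutativeRing c ℓ) where
  private
    module R = CommutativeRing R

    -- Writing p - q as p + ι * q with ι = - 1# turns the multiplicative laws
    -- of R[i] into commutative semiring identities.
    module Laws where
      open CommutativeRing R
      open Solver commutativeSemiring using (solve; _:+_; _:*_; _:=_)
      open RingProperties ring using (-1*x≈-x)

      ι : Carrier
      ι = - 1#

      sub : ∀ p q → p - q ≈ p + ι * q
      sub p q = +-congˡ (sym (-1*x≈-x q))

      assoc-re : ∀ a b c d e f → (a * c - b * d) * e - (a * d + b * c) * f
                               ≈ a * (c * e - d * f) - b * (c * f + d * e)
      assoc-re a b c d e f =
        trans (sub _ _) (trans (+-congʳ (*-congʳ (sub _ _)))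
          (trans (solve 7 (λ a b c d e f ι →
                   (a :* c :+ ι :* (b :* d)) :* e :+ ι :* ((a :* d :+ b :* c) :* f)
                   := a :* (c :* e :+ ι :* (d :* f)) :+ ι :* (b :* (c :* f :+ d :* e)))
                   refl a b c d e f ι)
            (sym (trans (sub _ _) (+-congʳ (*-congˡ (sub _ _)))))))

      assoc-im : ∀ a b c d e f → (a * c - b * d) * f + (a * d + b * c) * e
                               ≈ a * (c * f + d * e) + b * (c * e - d * f)
      assoc-im a b c d e f =
        trans (+-congʳ (*-congʳ (sub _ _)))
          (trans (solve 7 (λ a b c d e f ι →
                   (a :* c :+ ι :* (b :* d)) :* f :+ (a :* d :+ b :* c) :* e
                   := a :* (c :* f :+ d :* e) :+ b :* (c :* e :+ ι :* (d :* f)))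
                   refl a b c d e f ι)
            (sym (+-congˡ (*-congˡ (sub _ _)))))

      distrib-re : ∀ a b c d e f → a * (c + e) - b * (d + f)
                                 ≈ (a * c - b * d) + (a * e - b * f)
      distrib-re a b c d e f =
        trans (sub _ _)
          (trans (solve 7 (λ a b c d e f ι →
                   a :* (c :+ e) :+ ι :* (b :* (d :+ f))
                   := (a :* c :+ ι :* (b :* d)) :+ (a :* e :+ ι :* (b :* f)))
                   refl a b c d e f ι)
            (sym (+-cong (sub _ _) (sub _ _))))

      distrib-im : ∀ a b c d e f → a * (d + f) + b * (c + e)
                                 ≈ (a * d + b * c) + (a * f + b * e)
      distrib-im = solve 6 (λ a b c d e f →
        a :* (d :+ f) :+ b :* (c :+ e) := (a :* d :+ b :* c) :+ (a :* f :+ b :* e)) refl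

      comm-re : ∀ a b c d → a * c - b * d ≈ c * a - d * b
      comm-re a b c d = +-cong (*-comm a c) (-‿cong (*-comm b d))

      comm-im : ∀ a b c d → a * d + b * c ≈ c * b + d * a
      comm-im a b c d = trans (+-comm _ _) (+-cong (*-comm b c) (*-comm a d))

      identity-re : ∀ a b → 1# * a - 0# * b ≈ a
      identity-re a b = trans (sub _ _)
        (trans (+-cong (*-identityˡ a) (trans (*-congˡ (zeroˡ b)) (zeroʳ ι))) (+-identityʳ a))

      identity-im : ∀ a b → 1# * b + 0# * a ≈ b
      identity-im a b = trans (+-cong (*-identityˡ b) (zeroˡ a)) (+-identityʳ b)

  infix  4 _≈ᵢ_
  infixl 6 _+ᵢ_
  infixl 7 _*ᵢ_

  record _[i] : Set c where
    constructor _,ᵢ_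
    field re im : R.Carrier

  open _[i] public

  record _≈ᵢ_ (x y : _[i]) : Set ℓ where
    constructor mk≈ᵢ
    field
      re-≈ : re x R.≈ re y
      im-≈ : im x R.≈ im y

  _+ᵢ_ _*ᵢ_ : _[i] → _[i] → _[i]
  (a ,ᵢ b) +ᵢ (c ,ᵢ d) = (a R.+ c) ,ᵢ (b R.+ d)
  (a ,ᵢ b) *ᵢ (c ,ᵢ d) = (a R.* c R.- b R.* d) ,ᵢ (a R.* d R.+ b R.* c)

  -ᵢ_ : _[i] → _[i]
  -ᵢ (a ,ᵢ b) = (R.- a) ,ᵢ (R.- b)

  commutativeRing : CommutativeRing c ℓ
  commutativeRing = record
    { Carrier = _[i]
    ; _≈_ = _≈ᵢ_
    ; _+_ = _+ᵢ_
    ; _*_ = _*ᵢ_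
    ; -_  = -ᵢ_
    ; 0#  = R.0# ,ᵢ R.0#
    ; 1#  = R.1# ,ᵢ R.0#
    ; isCommutativeRing = record
      { isRing = record
        { +-isAbelianGroup = record
          { isGroup = record
            { isMonoid = record
              { isSemigroup = record
                { isMagma = record
                  { isEquivalence = record
                    { refl  = mk≈ᵢ R.refl R.refl
                    ; sym   = λ (mk≈ᵢ p q) → mk≈ᵢ (R.sym p) (R.sym q)
                    ; trans = λ (mk≈ᵢ p q) (mk≈ᵢ r s) → mk≈ᵢ (R.trans p r) (R.trans q s)
                    }
                  ; ∙-cong = λ (mk≈ᵢ p q) (mk≈ᵢ r s) → mk≈ᵢ (R.+-cong p r) (R.+-cong q s)
                  }
                ; assoc = λ _ _ _ → mk≈ᵢ (R.+-assoc _ _ _) (R.+-assoc _ _ _)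
                }
              ; identity = (λ _ → mk≈ᵢ (R.+-identityˡ _) (R.+-identityˡ _))
                         , (λ _ → mk≈ᵢ (R.+-identityʳ _) (R.+-identityʳ _))
              }
            ; inverse = (λ _ → mk≈ᵢ (R.-‿inverseˡ _) (R.-‿inverseˡ _))
                      , (λ _ → mk≈ᵢ (R.-‿inverseʳ _) (R.-‿inverseʳ _))
            ; ⁻¹-cong = λ (mk≈ᵢ p q) → mk≈ᵢ (R.-‿cong p) (R.-‿cong q)
            }
          ; comm = λ _ _ → mk≈ᵢ (R.+-comm _ _) (R.+-comm _ _)
          }
        ; *-cong = *ᵢ-cong
        ; *-assoc = λ (a ,ᵢ b) (c ,ᵢ d) (e ,ᵢ f) →
            mk≈ᵢ (assoc-re a b c d e f) (assoc-im a b c d e f)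
        ; *-identity = identityˡ , λ x → R[i]-trans (*ᵢ-comm x _) (identityˡ x)
        ; distrib = distribˡ , λ x y z → R[i]-trans (*ᵢ-comm (y +ᵢ z) x)
            (R[i]-trans (distribˡ x y z) (+ᵢ-cong (*ᵢ-comm x y) (*ᵢ-comm x z)))
        }
      ; *-comm = *ᵢ-comm
      }
    }
    where
    open Laws

    R[i]-trans : ∀ {x y z} → x ≈ᵢ y → y ≈ᵢ z → x ≈ᵢ z
    R[i]-trans (mk≈ᵢ p q) (mk≈ᵢ r s) = mk≈ᵢ (R.trans p r) (R.trans q s)

    +ᵢ-cong : ∀ {x x′ y y′} → x ≈ᵢ x′ → y ≈ᵢ y′ → x +ᵢ y ≈ᵢ x′ +ᵢ y′
    +ᵢ-cong (mk≈ᵢ p q) (mk≈ᵢ r s) = mk≈ᵢ (R.+-cong p r) (R.+-cong q s)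

    *ᵢ-cong : ∀ {x x′ y y′} → x ≈ᵢ x′ → y ≈ᵢ y′ → x *ᵢ y ≈ᵢ x′ *ᵢ y′
    *ᵢ-cong (mk≈ᵢ p q) (mk≈ᵢ r s) =
      mk≈ᵢ (R.+-cong (R.*-cong p r) (R.-‿cong (R.*-cong q s)))
           (R.+-cong (R.*-cong p s) (R.*-cong q r))

    *ᵢ-comm : ∀ x y → x *ᵢ y ≈ᵢ y *ᵢ x
    *ᵢ-comm (a ,ᵢ b) (c ,ᵢ d) = mk≈ᵢ (comm-re a b c d) (comm-im a b c d)

    identityˡ : ∀ x → (R.1# ,ᵢ R.0#) *ᵢ x ≈ᵢ x
    identityˡ (a ,ᵢ b) = mk≈ᵢ (identity-re a b) (identity-im a b)

    distribˡ : ∀ x y z → x *ᵢ (y +ᵢ z) ≈ᵢ x *ᵢ y +ᵢ x *ᵢ z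
    distribˡ (a ,ᵢ b) (c ,ᵢ d) (e ,ᵢ f) =
      mk≈ᵢ (distrib-re a b c d e f) (distrib-im a b c d e f)

ℂ-commutativeRing : CommutativeRing 0ℓ 0ℓ
ℂ-commutativeRing = Gaussian.commutativeRing ℝ-commutativeRing

private
  module ℂ = CommutativeRing ℂ-commutativeRing

ℂ : Set
ℂ = ℂ.Carrier

record Subfield (ℓ : Level) : Set (suc ℓ) where
  infix 4 _∈K
  field
    _∈K        : ℂ → Set ℓ
    -- ℂ is a setoid, so a subset must be closed under its equality.
    ∈-resp-≈   : ∀ {x y} → x ℂ.≈ y → x ∈K → y ∈K
    0-closed   : ℂ.0# ∈K
    1-closed   : ℂ.1# ∈K
    +-closed   : ∀ {x y} → x ∈K → y ∈K → (x ℂ.+ y) ∈K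
    *-closed   : ∀ {x y} → x ∈K → y ∈K → (x ℂ.* y) ∈K
    neg-closed : ∀ {x} → x ∈K → (ℂ.- x) ∈K
    inv-closed : ∀ {x} → x ∈K → ¬ (x ℂ.≈ ℂ.0#) → ∃[ y ] (y ∈K × x ℂ.* y ℂ.≈ ℂ.1#)

  commutativeRing : CommutativeRing ℓ 0ℓ
  commutativeRing = record
    { Carrier = Σ ℂ _∈K
    ; _≈_ = λ (x , _) (y , _) → x ℂ.≈ y
    ; _+_ = λ (x , p) (y , q) → x ℂ.+ y , +-closed p q
    ; _*_ = λ (x , p) (y , q) → x ℂ.* y , *-closed p q
    ; -_  = λ (x , p) → ℂ.- x , neg-closed p
    ; 0#  = ℂ.0# , 0-closed
    ; 1#  = ℂ.1# , 1-closed
    ; isCommutativeRing =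
        RingMonomorphism.isCommutativeRing inclusion ℂ.isCommutativeRing
    }
    where
    inclusion : IsRingMonomorphism _ ℂ.rawRing proj₁
    inclusion = record
      { isRingHomomorphism = record
        { isSemiringHomomorphism = record
          { isNearSemiringHomomorphism = record
            { +-isMonoidHomomorphism = record
              { isMagmaHomomorphism = record
                { isRelHomomorphism = record { cong = λ p → p }
                ; homo = λ _ _ → ℂ.refl
                }
              ; ε-homo = ℂ.refl
              }
            ; *-homo = λ _ _ → ℂ.refl
            }
          ; 1#-homo = ℂ.refl
          }
        ; -‿homo = λ _ → ℂ.refl
        }
      ; injective = λ p → p
      }

module LinearAlgebra (R : CommutativeRing c ℓ) where
  open CommutativeRing R
  open Sum +-commutativeMonoid using (sum)

  infix  4 _≋_ _≋ₜ_ _∈Span_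
  infixl 7 _∙_

  Vect : ℕ → Set c
  Vect n = Fin n → Carrier

  NonZeroVect : ∀ {n} → Vect n → Set ℓ
  NonZeroVect v = ¬ (∀ i → v i ≈ 0#)

  Matrix : ℕ → ℕ → Set c
  Matrix m n = Fin m → Fin n → Carrier

  _≋_ : ∀ {m n} → Matrix m n → Matrix m n → Set ℓ
  A ≋ B = ∀ i j → A i j ≈ B i j

  _∙_ : ∀ {l m n} → Matrix l m → Matrix m n → Matrix l n
  (A ∙ B) i k = sum (λ j → A i j * B j k)

  diag : ∀ {n} → Vect n → Matrix n n
  diag d i j = if does (i ≟ j) then d i else 0#

  𝟙 : ∀ {n} → Matrix n n
  𝟙 = diag (λ _ → 1#)

  IsInverse : ∀ {n} → Matrix n n → Matrix n n → Set ℓ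
  IsInverse A B = (A ∙ B ≋ 𝟙) × (B ∙ A ≋ 𝟙)

  Invertible : ∀ {n} → Matrix n n → Set (c ⊔ ℓ)
  Invertible {n} A = Σ[ B ∈ Matrix n n ] IsInverse A B

  Commute : ∀ {n} → Matrix n n → Matrix n n → Set ℓ
  Commute A B = A ∙ B ≋ B ∙ A

  Diagonalizable : ∀ {n} → Matrix n n → Set (c ⊔ ℓ)
  Diagonalizable {n} A = Σ[ P ∈ Matrix n n ] Σ[ P⁻¹ ∈ Matrix n n ] Σ[ d ∈ Vect n ]
    (IsInverse P P⁻¹ × A ≋ P ∙ diag d ∙ P⁻¹)

  _∈Span_ : ∀ {m n p} → Matrix m n → (Fin p → Matrix m n) → Set (c ⊔ ℓ)
  _∈Span_ {p = p} A Z = Σ[ a ∈ Vect p ] (A ≋ λ i j → sum (λ k → a k * Z k i j))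

  Tensor : ℕ → ℕ → ℕ → Set c
  Tensor m n p = Fin m → Fin n → Fin p → Carrier

  _≋ₜ_ : ∀ {m n p} → Tensor m n p → Tensor m n p → Set ℓ
  T ≋ₜ U = ∀ i j k → T i j k ≈ U i j k

  slice : ∀ {m n p} → Tensor m n p → Fin p → Matrix m n
  slice T k i j = T i j k

  _⊗_⊗_ : ∀ {m n p} → Vect m → Vect n → Vect p → Tensor m n p
  (u ⊗ v ⊗ w) i j k = u i * v j * w k

  RankOne : ∀ {m n p} → Tensor m n p → Set (c ⊔ ℓ)
  RankOne {m} {n} {p} T = Σ[ u ∈ Vect m ] Σ[ v ∈ Vect n ] Σ[ w ∈ Vect p ]
    (NonZeroVect u × NonZeroVect v × NonZeroVect w × T ≋ₜ u ⊗ v ⊗ w)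

  SumOfRankOnes : ∀ {m n p} → Tensor m n p → ℕ → Set (c ⊔ ℓ)
  SumOfRankOnes {m} {n} {p} T r = Σ[ X ∈ (Fin r → Tensor m n p) ]
    ((∀ s → RankOne (X s)) × T ≋ₜ λ i j k → sum (λ s → X s i j k))

  HasRank : ∀ {m n p} → Tensor m n p → ℕ → Set (c ⊔ ℓ)
  HasRank T r = SumOfRankOnes T r × (∀ s → SumOfRankOnes T s → r ℕ.≤ s)

  Rank≤ : ∀ {m n p} → Tensor m n p → ℕ → Set (c ⊔ ℓ)
  Rank≤ T r = Σ[ s ∈ ℕ ] (HasRank T s × s ℕ.≤ r)

  SpanHasInvertible : ∀ {n p} → (Fin p → Matrix n n) → Set (c ⊔ ℓ)
  SpanHasInvertible {n} Z = Σ[ A ∈ Matrix n n ] (A ∈Span Z × Invertible A)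

  Subtensor : ∀ {n r p} → n ℕ.≤ r → Tensor n n p → Tensor r r p → Set ℓ
  Subtensor n≤r T S = ∀ i j k → T i j k ≈ S (inject≤ i n≤r) (inject≤ j n≤r) k

{-# OPTIONS --safe #-}

-- A decomposition of T into r triads reads T_k = U D_k V with D_k diagonal. As the slices of T span an
-- invertible matrix, U has independent rows and V independent columns, so they complete to invertible
-- r × r matrices P and Q, and S_k = P D_k Q is the required extension: its slices satisfy
-- Z⁻¹ S_k = Q⁻¹ (D⁻¹ D_k) Q for each invertible Z = P D Q in their span. Conversely, commuting
-- diagonalizable matrices Z⁻¹ S_k have a common left eigenbasis P, so S_k = Z P⁻¹ D_k P is a sum of r
-- triads, and T is obtained from it by restriction. The completion of U and V and the choice of the
-- eigenbasis among all joint eigenvectors are two instances of Steinitz exchange.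
module Submission where

open import Algebra.Bundles using (CommutativeRing)
import Algebra.Properties.CommutativeSemigroup as CommutativeSemigroupProperties
import Algebra.Properties.Monoid.Mult as MonoidMult
import Algebra.Properties.Ring as RingProperties
import Algebra.Properties.Semiring.Sum as SemiringSum
import Algebra.Solver.Ring.NaturalCoefficients.Default as Solver
open import Axiom.ExcludedMiddle using (ExcludedMiddle)
open import Data.Fin.Base using (Fin; zero; suc; inject≤; toℕ)
open import Data.Fin.Properties using (any?; all?; _≟_; pigeonhole; ¬∀⟶∃¬)
open import Data.Nat.Base as ℕ using (ℕ; zero; suc; _≤_; _<_; NonZero; z≤n; s≤s; _≤′_; ≤′-refl; ≤′-step)
open import Data.Nat.Properties using (n<1+n; m≤n⇒∃[o]m+o≡n; +-suc; ≤-refl; ≤-trans; m≤n⇒m≤1+n; ≤⇒≤′)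
open import Data.Product.Base using (_×_; Σ-syntax; ∃-syntax; _,_; proj₁; proj₂)
open import Data.Rational.Base as ℚ using (0ℚ; 1ℚ)
import Data.Rational.Properties as ℚ
open import Data.Vec.Functional using (_∷_)
open import Function.Base using (_∘_)
open import Function.Bundles using (_⇔_; mk⇔)
open import Level using (Level; _⊔_; Lift; lift; lower)
open import Relation.Binary.Bundles using (Setoid)
open import Relation.Binary.PropositionalEquality as ≡ using (_≡_)
import Relation.Binary.Reasoning.Setoid as SetoidReasoning
open import Relation.Nullary using (¬_; Dec; yes; no; contradiction)
open import Relation.Nullary.Decidable using (map′; decidable-stable; _→-dec_)
open import Defs
open Gaussian ℝ-commutativeRing using (re; mk≈ᵢ)

-- Matrix algebra over a commutative ring

module MatrixAlgebra {c ℓ} (R : CommutativeRing c ℓ) where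
  open CommutativeRing R hiding (zero)
  open LinearAlgebra R
  open SemiringSum semiring public
    using (sum; sum-cong-≋; ∑-comm; ∑-distrib-+; *-distribˡ-sum; *-distribʳ-sum; sum-replicate-zero)

  infixl 7 _·_ _◂_
  infixr 7 _▸_
  infix  8 _ᵀ

  _·_ : ∀ {n} → Vect n → Vect n → Carrier
  x · y = sum (λ i → x i * y i)

  _◂_ : ∀ {m n} → Vect m → Matrix m n → Vect n
  (x ◂ A) j = sum (λ i → x i * A i j)

  _▸_ : ∀ {m n} → Matrix m n → Vect n → Vect m
  (A ▸ y) i = A i · y

  _ᵀ : ∀ {m n} → Matrix m n → Matrix n m
  (A ᵀ) i j = A j i

  sum-zero : ∀ {n} {t : Vect n} → (∀ i → t i ≈ 0#) → sum t ≈ 0#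
  sum-zero {n} t≈0 = trans (sum-cong-≋ t≈0) (sum-replicate-zero n)

  ·-cong : ∀ {n} {x x′ y y′ : Vect n} → (∀ i → x i ≈ x′ i) → (∀ i → y i ≈ y′ i) → x · y ≈ x′ · y′
  ·-cong p q = sum-cong-≋ (λ i → *-cong (p i) (q i))

  ·-congˡ : ∀ {n} (x : Vect n) {y y′ : Vect n} → (∀ i → y i ≈ y′ i) → x · y ≈ x · y′
  ·-congˡ x = ·-cong {x = x} (λ _ → refl)

  ·-congʳ : ∀ {n} {x x′ : Vect n} (y : Vect n) → (∀ i → x i ≈ x′ i) → x · y ≈ x′ · y
  ·-congʳ y p = ·-cong {y = y} p (λ _ → refl)

  ·-comm : ∀ {n} (x y : Vect n) → x · y ≈ y · x
  ·-comm x y = sum-cong-≋ (λ i → *-comm (x i) (y i))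

  ·-zeroˡ : ∀ {n} {x : Vect n} (y : Vect n) → (∀ i → x i ≈ 0#) → x · y ≈ 0#
  ·-zeroˡ y x≈0 = sum-zero (λ i → trans (*-congʳ (x≈0 i)) (zeroˡ (y i)))

  ·-zeroʳ : ∀ {n} (x : Vect n) {y : Vect n} → (∀ i → y i ≈ 0#) → x · y ≈ 0#
  ·-zeroʳ x y≈0 = sum-zero (λ i → trans (*-congˡ (y≈0 i)) (zeroʳ (x i)))

  ·-distribˡ-+ : ∀ {n} (x y z : Vect n) → x · (λ i → y i + z i) ≈ x · y + x · z
  ·-distribˡ-+ x y z = trans (sum-cong-≋ (λ i → distribˡ (x i) (y i) (z i)))
    (∑-distrib-+ (λ i → x i * y i) (λ i → x i * z i))

  ·-*-assocʳ : ∀ {n} (x y : Vect n) a → x · (λ i → y i * a) ≈ x · y * a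
  ·-*-assocʳ x y a = sym (trans (*-distribʳ-sum a (λ i → x i * y i))
    (sum-cong-≋ (λ i → *-assoc (x i) (y i) a)))

  -- Interchange of the two summations. Associativity of the matrix product is this identity at each
  -- row and column.
  ◂-·-assoc : ∀ {m n} (x : Vect m) (A : Matrix m n) (y : Vect n) → (x ◂ A) · y ≈ x · (A ▸ y)
  ◂-·-assoc x A y = begin
    sum (λ j → sum (λ i → x i * A i j) * y j)    ≈⟨ sum-cong-≋ (λ j → *-distribʳ-sum (y j) (λ i → x i * A i j)) ⟩
    sum (λ j → sum (λ i → x i * A i j * y j))    ≈⟨ ∑-comm (λ j i → x i * A i j * y j) ⟩
    sum (λ i → sum (λ j → x i * A i j * y j))    ≈⟨ sum-cong-≋ (λ i → sum-cong-≋ (λ j → *-assoc (x i) (A i j) (y j))) ⟩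
    sum (λ i → sum (λ j → x i * (A i j * y j)))  ≈⟨ sum-cong-≋ (λ i → sym (*-distribˡ-sum (x i) (λ j → A i j * y j))) ⟩
    sum (λ i → x i * sum (λ j → A i j * y j))    ∎
    where open SetoidReasoning setoid

  diag-▸ : ∀ {n} (d x : Vect n) i → (diag d ▸ x) i ≈ d i * x i
  diag-▸ d x zero    = trans (+-congˡ (·-zeroˡ (x ∘ suc) (λ _ → refl))) (+-identityʳ _)
  diag-▸ d x (suc i) = trans (+-cong (zeroˡ _) (diag-▸ (d ∘ suc) (x ∘ suc) i)) (+-identityˡ _)

  ◂-diag : ∀ {n} (x d : Vect n) j → (x ◂ diag d) j ≈ x j * d j
  ◂-diag x d zero    = trans (+-congˡ (·-zeroʳ (x ∘ suc) (λ _ → refl))) (+-identityʳ _)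
  ◂-diag x d (suc j) = trans (+-cong (zeroʳ _) (◂-diag (x ∘ suc) (d ∘ suc) j)) (+-identityˡ _)

  𝟙-▸ : ∀ {n} (x : Vect n) i → (𝟙 ▸ x) i ≈ x i
  𝟙-▸ x i = trans (diag-▸ (λ _ → 1#) x i) (*-identityˡ (x i))

  ◂-𝟙 : ∀ {n} (x : Vect n) j → (x ◂ 𝟙) j ≈ x j
  ◂-𝟙 x j = trans (◂-diag x (λ _ → 1#) j) (*-identityʳ (x j))

  𝟙-sym : ∀ {n} (i j : Fin n) → 𝟙 i j ≈ 𝟙 j i
  𝟙-sym zero    zero    = refl
  𝟙-sym zero    (suc j) = refl
  𝟙-sym (suc i) zero    = refl
  𝟙-sym (suc i) (suc j) = 𝟙-sym i j

  𝟙-diagonal : ∀ {n} (i : Fin n) → 𝟙 i i ≈ 1#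
  𝟙-diagonal zero    = refl
  𝟙-diagonal (suc i) = 𝟙-diagonal i

  ≋-setoid : ℕ → ℕ → Setoid c ℓ
  ≋-setoid m n = record
    { Carrier = Matrix m n
    ; _≈_ = _≋_
    ; isEquivalence = record
      { refl  = λ _ _ → refl
      ; sym   = λ p i j → sym (p i j)
      ; trans = λ p q i j → trans (p i j) (q i j)
      }
    }

  module _ {m n : ℕ} where
    open Setoid (≋-setoid m n) public using () renaming (refl to ≋-refl; sym to ≋-sym; trans to ≋-trans)

  ∙-congˡ : ∀ {l m n} (A : Matrix l m) {B B′ : Matrix m n} → B ≋ B′ → A ∙ B ≋ A ∙ B′
  ∙-congˡ A p i j = ·-congˡ (A i) (λ k → p k j)

  ∙-congʳ : ∀ {l m n} {A A′ : Matrix l m} (B : Matrix m n) → A ≋ A′ → A ∙ B ≋ A′ ∙ B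
  ∙-congʳ B p i j = ·-congʳ (λ k → B k j) (p i)

  ∙-assoc : ∀ {k l m n} (A : Matrix k l) (B : Matrix l m) (C : Matrix m n) → A ∙ B ∙ C ≋ A ∙ (B ∙ C)
  ∙-assoc A B C i j = ◂-·-assoc (A i) B (λ k → C k j)

  ∙-identityˡ : ∀ {m n} (A : Matrix m n) → 𝟙 ∙ A ≋ A
  ∙-identityˡ A i j = 𝟙-▸ (λ k → A k j) i

  ∙-identityʳ : ∀ {m n} (A : Matrix m n) → A ∙ 𝟙 ≋ A
  ∙-identityʳ A i = ◂-𝟙 (A i)

  ᵀ-∙ : ∀ {l m n} (A : Matrix l m) (B : Matrix m n) → (A ∙ B) ᵀ ≋ B ᵀ ∙ A ᵀ
  ᵀ-∙ A B i j = ·-comm (A j) (λ k → B k i)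

  cancelˡ : ∀ {m n} {A B : Matrix m m} (C : Matrix m n) → A ∙ B ≋ 𝟙 → A ∙ (B ∙ C) ≋ C
  cancelˡ {A = A} {B} C AB = ≋-trans (≋-sym (∙-assoc A B C)) (≋-trans (∙-congʳ C AB) (∙-identityˡ C))

  cancelʳ : ∀ {m n} {A B : Matrix n n} (C : Matrix m n) → A ∙ B ≋ 𝟙 → C ∙ A ∙ B ≋ C
  cancelʳ {A = A} {B} C AB = ≋-trans (∙-assoc C A B) (≋-trans (∙-congˡ C AB) (∙-identityʳ C))

  IsInverse-sym : ∀ {n} {A B : Matrix n n} → IsInverse A B → IsInverse B A
  IsInverse-sym (p , q) = q , p

  ∙-isInverse : ∀ {n} {A A′ B B′ : Matrix n n} →
                IsInverse A A′ → IsInverse B B′ → IsInverse (A ∙ B) (B′ ∙ A′)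
  ∙-isInverse (AA′ , A′A) (BB′ , B′B) = half AA′ BB′ , half B′B A′A
    where
    half : ∀ {n} {A A′ B B′ : Matrix n n} → A ∙ A′ ≋ 𝟙 → B ∙ B′ ≋ 𝟙 → A ∙ B ∙ (B′ ∙ A′) ≋ 𝟙
    half {A = A} {A′} {B} {B′} AA′ BB′ =
      ≋-trans (∙-assoc A B _) (≋-trans (∙-congˡ A (cancelˡ A′ BB′)) AA′)

  IsInverse-respˡ : ∀ {n} {A A′ B : Matrix n n} → A ≋ A′ → IsInverse A B → IsInverse A′ B
  IsInverse-respˡ {B = B} A≋A′ (AB , BA) =
    ≋-trans (∙-congʳ B (≋-sym A≋A′)) AB , ≋-trans (∙-congˡ B (≋-sym A≋A′)) BA

  ᵀ-isInverse : ∀ {n} {A B : Matrix n n} → IsInverse A B → IsInverse (A ᵀ) (B ᵀ)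
  ᵀ-isInverse {n} {A} {B} (AB , BA) = half {A = B} {A} BA , half {A = A} {B} AB
    where
    half : ∀ {A B : Matrix n n} → A ∙ B ≋ 𝟙 → B ᵀ ∙ A ᵀ ≋ 𝟙
    half {A} {B} AB i j = trans (sym (ᵀ-∙ A B i j)) (trans (AB j i) (𝟙-sym j i))

  invertible-cancelʳ : ∀ {n} (A B B′ : Matrix n n) → IsInverse B B′ → Invertible (A ∙ B) → Invertible A
  invertible-cancelʳ A B B′ B-inv (N , AB-inv) = B ∙ N ,
    IsInverse-respˡ (cancelʳ A (proj₁ B-inv)) (∙-isInverse AB-inv (IsInverse-sym B-inv))

  lowerRight : ∀ {m n} → Matrix (suc m) (suc n) → Matrix m n
  lowerRight M i j = M (suc i) (suc j)

  -- With first row e₀, `M` is block lower triangular: `y` stands below the corner 1 and `N` inverts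
  -- the remaining block. The inverse `L` has - N y below its corner. This carries invertibility
  -- back from the quotient by one coordinate.
  invertible-lowerRight : ∀ {n} (M : Matrix (suc n) (suc n)) → (∀ j → M zero j ≈ 𝟙 zero j) →
                          Invertible (lowerRight M) → Invertible M
  invertible-lowerRight {n} M M₀ (N , MN , NM) = L , ML , LM
    where
    y : Vect n
    y i = M (suc i) zero

    L : Matrix (suc n) (suc n)
    L zero    j       = 𝟙 zero j
    L (suc i) zero    = (N ▸ (-_ ∘ y)) i
    L (suc i) (suc j) = N i j

    ML : M ∙ L ≋ 𝟙
    ML zero j = trans (·-congʳ (λ k → L k j) M₀) (𝟙-▸ (λ k → L k j) zero)
    ML (suc i) zero = begin
      y i * 1# + (lowerRight M ▸ N ▸ (-_ ∘ y)) i    ≈⟨ +-cong (*-identityʳ (y i)) (sym (◂-·-assoc (lowerRight M i) N (-_ ∘ y))) ⟩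
      y i + ((lowerRight M ∙ N) ▸ (-_ ∘ y)) i       ≈⟨ +-congˡ (trans (·-congʳ (-_ ∘ y) (MN i)) (𝟙-▸ (-_ ∘ y) i)) ⟩
      y i - y i                                     ≈⟨ -‿inverseʳ (y i) ⟩
      0#                                            ∎
      where open SetoidReasoning setoid
    ML (suc i) (suc j) = trans (+-congʳ (zeroʳ (y i))) (trans (+-identityˡ _) (MN i j))

    LM : L ∙ M ≋ 𝟙
    LM zero j = trans (𝟙-▸ (λ k → M k j) zero) (M₀ j)
    LM (suc i) zero = begin
      (N ▸ (-_ ∘ y)) i * M zero zero + (N ▸ y) i  ≈⟨ +-congʳ (trans (*-congˡ (M₀ zero)) (*-identityʳ _)) ⟩
      (N ▸ (-_ ∘ y)) i + (N ▸ y) i                ≈⟨ ·-distribˡ-+ (N i) (-_ ∘ y) y ⟨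
      N i · (λ k → - y k + y k)                   ≈⟨ ·-zeroʳ (N i) (λ k → -‿inverseˡ (y k)) ⟩
      0#                                          ∎
      where open SetoidReasoning setoid
    LM (suc i) (suc j) = trans (+-congʳ (trans (*-congˡ (M₀ (suc j))) (zeroʳ _)))
                               (trans (+-identityˡ _) (NM i j))

-- Linear algebra over a field of characteristic zero

record IsFieldOfCharacteristicZero {c ℓ} (R : CommutativeRing c ℓ) : Set (c ⊔ ℓ) where
  open CommutativeRing R
  open MonoidMult +-monoid using () renaming (_×_ to _×ₘ_)
  field
    inverse : ∀ x → ¬ (x ≈ 0#) → ∃[ y ] x * y ≈ 1#
    char0   : ∀ n → ¬ (suc n ×ₘ 1# ≈ 0#)

  1≉0 : ¬ (1# ≈ 0#)
  1≉0 1≈0 = char0 0 (trans (+-identityʳ 1#) 1≈0)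

module ClassicalField {c ℓ} (R : CommutativeRing c ℓ) (isField : IsFieldOfCharacteristicZero R)
                      (em : ExcludedMiddle (c ⊔ ℓ)) where
  open IsFieldOfCharacteristicZero isField
  open CommutativeRing R hiding (zero)
  open LinearAlgebra R
  open MatrixAlgebra R
  open CommutativeSemigroupProperties *-commutativeSemigroup using (xy∙z≈xz∙y; x∙yz≈y∙xz)
  open MonoidMult +-monoid using (×-homo-+; ×-congˡ) renaming (_×_ to _×ₘ_)
  open RingProperties ring using (-‿distribˡ-*; -1*x≈-x; //-rightDividesˡ; //-rightDividesʳ; +-identityʳ-unique; +-cancelʳ;
    x∙y⁻¹≈ε⇒x≈y; x≈y⇒x∙y⁻¹≈ε; x[y-z]≈xy-xz)

  infix 4 _≈?_
  _≈?_ : ∀ x y → Dec (x ≈ y)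
  x ≈? y = map′ lower lift (em {Lift c (x ≈ y)})

  -- Elementary matrices and Steinitz exchange

  module Shear {n} (a b : Vect n) where
    open Solver commutativeSemiring using (solve; _:+_; _:*_; _:=_)

    shear : Carrier → Matrix n n
    shear κ i j = 𝟙 i j + a i * (b j * κ)

    ◂-shear : ∀ x κ j → (x ◂ shear κ) j ≈ x j + x · a * (b j * κ)
    ◂-shear x κ j = trans (·-distribˡ-+ x (λ i → 𝟙 i j) (λ i → a i * (b j * κ)))
      (+-cong (◂-𝟙 x j) (·-*-assocʳ x a (b j * κ)))

    shear-▸ : ∀ κ i → (shear κ ▸ a) i ≈ a i + a · b * (κ * a i)
    shear-▸ κ i = begin
      (shear κ ▸ a) i                                ≈⟨ ·-comm (shear κ i) a ⟩
      a · shear κ i                                  ≈⟨ ·-distribˡ-+ a (𝟙 i) (λ k → a i * (b k * κ)) ⟩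
      a · 𝟙 i + a · (λ k → a i * (b k * κ))          ≈⟨ +-cong (trans (·-comm a (𝟙 i)) (𝟙-▸ a i))
                                                          (·-congˡ a (λ k → trans (*-comm _ _) (*-assoc _ _ _))) ⟩
      a i + a · (λ k → b k * (κ * a i))              ≈⟨ +-congˡ (·-*-assocʳ a b (κ * a i)) ⟩
      a i + a · b * (κ * a i)                        ∎
      where open SetoidReasoning setoid

    -- The product of 1 + κ a ⊗ b and 1 + κ′ a ⊗ b is 1 + (κ + κ′ + κ κ′ (a · b)) a ⊗ b, because the
    -- inner contraction of the two rank-one parts is the scalar a · b. The hypothesis makes the
    -- coefficient vanish.
    shear-∙ : ∀ κ κ′ → κ + κ′ + κ * κ′ * (a · b) ≈ 0# → shear κ ∙ shear κ′ ≋ 𝟙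
    shear-∙ κ κ′ eq i j = begin
      (shear κ ∙ shear κ′) i j
        ≈⟨ ◂-shear (shear κ i) κ′ j ⟩
      shear κ i j + (shear κ ▸ a) i * (b j * κ′)
        ≈⟨ +-congˡ (*-congʳ (shear-▸ κ i)) ⟩
      𝟙 i j + a i * (b j * κ) + (a i + a · b * (κ * a i)) * (b j * κ′)
        ≈⟨ solve 6 (λ e a b κ κ′ β →
             e :+ a :* (b :* κ) :+ (a :+ β :* (κ :* a)) :* (b :* κ′)
             := e :+ a :* b :* (κ :+ κ′ :+ κ :* κ′ :* β)) refl (𝟙 i j) (a i) (b j) κ κ′ (a · b) ⟩
      𝟙 i j + a i * b j * (κ + κ′ + κ * κ′ * (a · b))
        ≈⟨ +-congˡ (trans (*-congˡ eq) (zeroʳ _)) ⟩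
      𝟙 i j + 0#
        ≈⟨ +-identityʳ _ ⟩
      𝟙 i j ∎
      where open SetoidReasoning setoid

  -- Normalizing the head of `a` gives (u - e₀) · a + 1 = u · a, the relation that makes the two
  -- shears in `exchange` mutually inverse. Either e₀ itself works, or u₀ = 0 and the head of `ρ`
  -- can be replaced by 1 without changing the pairing.
  nonzero-pairing-with-head-1 : ∀ {n} (u ρ : Vect (suc n)) → u · ρ ≈ 1# →
                Σ[ a ∈ Vect (suc n) ] a zero ≈ 1# × ¬ (u · a ≈ 0#)
  nonzero-pairing-with-head-1 u ρ uρ≈1 with u zero ≈? 0#
  ... | no u₀≉0 = 𝟙 zero , refl , λ ua≈0 → u₀≉0 (begin
    u zero       ≈⟨ 𝟙-▸ u zero ⟨
    𝟙 zero · u   ≈⟨ ·-comm (𝟙 zero) u ⟩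
    u · 𝟙 zero   ≈⟨ ua≈0 ⟩
    0#           ∎)
    where open SetoidReasoning setoid
  ... | yes u₀≈0 = a , refl , λ ua≈0 → 1≉0 (begin
    1#                                          ≈⟨ uρ≈1 ⟨
    u zero * ρ zero + (u ∘ suc) · (ρ ∘ suc)     ≈⟨ +-congʳ (trans (*-congʳ u₀≈0) (zeroˡ _)) ⟩
    0# + (u ∘ suc) · (ρ ∘ suc)                  ≈⟨ +-congʳ (trans (*-identityʳ _) u₀≈0) ⟨
    u zero * 1# + (u ∘ suc) · (ρ ∘ suc)         ≈⟨ ua≈0 ⟩
    0#                                          ∎)
    where
    open SetoidReasoning setoid
    a : Vect _
    a zero    = 1#
    a (suc i) = ρ (suc i)

  -- Witness: G = 1 - (u · a)⁻¹ a ⊗ (u - e₀) with a₀ = 1 and u · a ≠ 0;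
  -- its inverse is 1 + a ⊗ (u - e₀).
  exchange : ∀ {n} (u ρ : Vect (suc n)) → u · ρ ≈ 1# →
             Σ[ G ∈ Matrix (suc n) (suc n) ] Invertible G × (∀ j → (u ◂ G) j ≈ 𝟙 zero j)
  exchange u ρ uρ≈1 with nonzero-pairing-with-head-1 u ρ uρ≈1
  ... | a , a₀≈1 , ua≉0 with inverse (u · a) ua≉0
  ... | δ , γδ≈1 = shear (- δ) , (shear 1# , shear-∙ (- δ) 1# cancels′ , shear-∙ 1# (- δ) cancels) , u◂G
    where
    open SetoidReasoning setoid
    b : Vect _
    b j = u j - 𝟙 zero j
    open Shear a b

    γ = u · a

    a·b : a · b + 1# ≈ γ
    a·b = begin
      a · b + 1#                  ≈⟨ +-congˡ (trans (𝟙-▸ a zero) a₀≈1) ⟨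
      a · b + 𝟙 zero · a          ≈⟨ +-congˡ (·-comm (𝟙 zero) a) ⟩
      a · b + a · 𝟙 zero          ≈⟨ ·-distribˡ-+ a b (𝟙 zero) ⟨
      a · (λ i → b i + 𝟙 zero i)  ≈⟨ ·-congˡ a (λ i → //-rightDividesˡ (𝟙 zero i) (u i)) ⟩
      a · u                       ≈⟨ ·-comm a u ⟩
      γ                           ∎

    -δγ≈-1 : - δ * γ ≈ - 1#
    -δγ≈-1 = trans (sym (-‿distribˡ-* δ γ)) (-‿cong (trans (*-comm δ γ) γδ≈1))

    cancels : 1# + - δ + 1# * - δ * (a · b) ≈ 0#
    cancels = begin
      1# + - δ + 1# * - δ * (a · b)     ≈⟨ +-assoc _ _ _ ⟩
      1# + (- δ + 1# * - δ * (a · b))   ≈⟨ +-congˡ (+-cong (sym (*-identityʳ _)) (*-congʳ (*-identityˡ _))) ⟩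
      1# + (- δ * 1# + - δ * (a · b))   ≈⟨ +-congˡ (distribˡ (- δ) 1# (a · b)) ⟨
      1# + - δ * (1# + a · b)           ≈⟨ +-congˡ (trans (*-congˡ (trans (+-comm _ _) a·b)) -δγ≈-1) ⟩
      1# - 1#                           ≈⟨ -‿inverseʳ 1# ⟩
      0#                                ∎

    cancels′ : - δ + 1# + - δ * 1# * (a · b) ≈ 0#
    cancels′ = trans (+-cong (+-comm _ _) (*-congʳ (*-comm _ _))) cancels

    u◂G : ∀ j → (u ◂ shear (- δ)) j ≈ 𝟙 zero j
    u◂G j = begin
      (u ◂ shear (- δ)) j
        ≈⟨ ◂-shear u (- δ) j ⟩
      u j + γ * (b j * - δ)
        ≈⟨ +-congˡ (trans (*-comm _ _) (*-assoc (b j) (- δ) γ)) ⟩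
      u j + b j * (- δ * γ)
        ≈⟨ +-cong (sym (//-rightDividesˡ (𝟙 zero j) (u j))) (trans (*-congˡ -δγ≈-1) (trans (*-comm _ _) (-1*x≈-x (b j)))) ⟩
      b j + 𝟙 zero j - b j
        ≈⟨ +-congʳ (+-comm _ _) ⟩
      𝟙 zero j + b j - b j
        ≈⟨ //-rightDividesʳ (b j) (𝟙 zero j) ⟩
      𝟙 zero j ∎

  -- The image of f spans; stated dually, this passes to the quotient by one coordinate without choosing coefficients.
  Separating : ∀ {n} {I : Set (c ⊔ ℓ)} → (I → Vect n) → Set (c ⊔ ℓ)
  Separating {n} f = ∀ (w : Vect n) → (∀ i → f i · w ≈ 0#) → ∀ j → w j ≈ 0#

  -- Independence of the rows, witnessed by a dual family of columns. The first column of `V` is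
  -- then the vector `ρ` that `exchange` asks for.
  RightInvertible : ∀ {m n} → Matrix m n → Set (c ⊔ ℓ)
  RightInvertible {m} {n} U = Σ[ V ∈ Matrix n m ] U ∙ V ≋ 𝟙

  -- Otherwise every `f i` vanishes, so e₀ annihilates the whole family and separation forces 1 = 0.
  -- Once a nonzero entry is found, `ρ` is a coordinate vector scaled by its inverse.
  separating⇒nonzero : ∀ {n} {I : Set (c ⊔ ℓ)} (f : I → Vect (suc n)) → Separating f →
                       Σ[ i ∈ I ] Σ[ ρ ∈ Vect (suc n) ] f i · ρ ≈ 1#
  separating⇒nonzero f sep with em {Σ[ i ∈ _ ] ∃[ j ] ¬ (f i j ≈ 0#)}
  ... | no none = contradiction (sep (𝟙 zero) (λ i → ·-zeroˡ (𝟙 zero) (λ j →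
          decidable-stable (f i j ≈? 0#) (λ fij≉0 → none (i , j , fij≉0)))) zero) 1≉0
  ... | yes (i , j , fij≉0) with inverse (f i j) fij≉0
  ...   | y , eq = i , (λ k → 𝟙 k j * y) , (begin
    f i · (λ k → 𝟙 k j * y)     ≈⟨ ·-*-assocʳ (f i) (λ k → 𝟙 k j) y ⟩
    (f i ◂ 𝟙) j * y             ≈⟨ *-congʳ (◂-𝟙 (f i) j) ⟩
    f i j * y                   ≈⟨ eq ⟩
    1#                          ∎)
    where open SetoidReasoning setoid

  -- Indices are recorded rather than vectors, so an added row keeps the data that `I` attaches to
  -- it, such as its eigenvalues.
  Completion : ∀ {n r} {I : Set (c ⊔ ℓ)} → (I → Vect r) → (Fin n → I) → n ≤ r → Set (c ⊔ ℓ)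
  Completion {n} {r} {I} f g n≤r = Σ[ σ ∈ (Fin r → I) ] (∀ i → σ (inject≤ i n≤r) ≡ g i) × Invertible (f ∘ σ)

  -- After the change of coordinates `G`, dropping the first coordinate is the passage to the
  -- quotient by the line that `G` moves onto that of e₀.
  module Reduce {r} {I : Set (c ⊔ ℓ)} (f : I → Vect (suc r)) (sep : Separating f)
                (G G⁻¹ : Matrix (suc r) (suc r)) (G-inv : IsInverse G G⁻¹) where
    reduced : I → Vect r
    reduced i j = (f i ◂ G) (suc j)

    -- Extending `w` by 0 in the first coordinate, the pairing of `reduced i` with `w` equals that
    -- of `f i` with G w⁺. Hence G w⁺ = 0, and applying `G⁻¹` gives w = 0.
    reduced-separating : Separating reduced
    reduced-separating w f′w≈0 j = begin
      w j                          ≈⟨ 𝟙-▸ w⁺ (suc j) ⟨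
      (𝟙 ▸ w⁺) (suc j)             ≈⟨ ·-congʳ w⁺ (proj₂ G-inv (suc j)) ⟨
      ((G⁻¹ ∙ G) ▸ w⁺) (suc j)     ≈⟨ ◂-·-assoc (G⁻¹ (suc j)) G w⁺ ⟩
      (G⁻¹ ▸ G ▸ w⁺) (suc j)       ≈⟨ ·-zeroʳ (G⁻¹ (suc j)) (sep (G ▸ w⁺) f·Gw) ⟩
      0#                           ∎
      where
      open SetoidReasoning setoid
      w⁺ : Vect (suc r)
      w⁺ = 0# ∷ w
      f·Gw : ∀ i → f i · (G ▸ w⁺) ≈ 0#
      f·Gw i = begin
        f i · (G ▸ w⁺)                      ≈⟨ ◂-·-assoc (f i) G w⁺ ⟨
        (f i ◂ G) zero * 0# + reduced i · w ≈⟨ +-cong (zeroʳ _) (f′w≈0 i) ⟩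
        0# + 0#                             ≈⟨ +-identityˡ 0# ⟩
        0#                                  ∎

    lift-invertible : ∀ i₀ (σ : Fin r → I) → (∀ j → (f i₀ ◂ G) j ≈ 𝟙 zero j) →
                      Invertible (reduced ∘ σ) → Invertible (f ∘ (i₀ ∷ σ))
    lift-invertible i₀ σ f₀ inv =
      invertible-cancelʳ (f ∘ (i₀ ∷ σ)) G G⁻¹ G-inv (invertible-lowerRight ((f ∘ (i₀ ∷ σ)) ∙ G) f₀ inv)

    -- Writing U for `f ∘ g`, the first row of U G is e₀, so U G W = 1 forces the first row of `W`
    -- to be e₀ as well. That row contributes nothing to the later columns, so deleting the first
    -- row and column of `W` leaves a right inverse.
    reduced-rightInvertible : ∀ {n} (g : Fin (suc n) → I) → (∀ j → (f (g zero) ◂ G) j ≈ 𝟙 zero j) →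
                              RightInvertible (f ∘ g) → RightInvertible (reduced ∘ g ∘ suc)
    reduced-rightInvertible {n} g f₀ (V , UV) = (λ k j → W (suc k) (suc j)) , λ i j → begin
      (reduced (g (suc i))) · (λ k → W (suc k) (suc j))      ≈⟨ +-identityˡ _ ⟨
      0# + (reduced (g (suc i))) · (λ k → W (suc k) (suc j)) ≈⟨ +-congʳ (trans (*-congˡ (W₀ (suc j))) (zeroʳ _)) ⟨
      ((f ∘ g) ∙ G ∙ W) (suc i) (suc j)                      ≈⟨ UGW (suc i) (suc j) ⟩
      𝟙 i j                                                  ∎
      where
      open SetoidReasoning setoid
      W : Matrix (suc r) (suc n)
      W = G⁻¹ ∙ V

      UGW : (f ∘ g) ∙ G ∙ W ≋ 𝟙
      UGW = ≋-trans (∙-assoc (f ∘ g) G W) (≋-trans (∙-congˡ (f ∘ g) (cancelˡ {A = G} {G⁻¹} V (proj₁ G-inv))) UV)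

      W₀ : ∀ j → W zero j ≈ 𝟙 zero j
      W₀ j = begin
        W zero j                          ≈⟨ 𝟙-▸ (λ k → W k j) zero ⟨
        𝟙 zero · (λ k → W k j)            ≈⟨ ·-congʳ (λ k → W k j) f₀ ⟨
        ((f ∘ g) ∙ G ∙ W) zero j          ≈⟨ UGW zero j ⟩
        𝟙 zero j                          ∎

  -- Induction on `r`: one vector is moved to e₀ and the rest is chosen in the quotient. Prescribed
  -- vectors come first; once they run out, separation supplies the next. The quotient family keeps
  -- the index set `I`, so indices chosen there serve for `f`.
  steinitz : ∀ {n r} {I : Set (c ⊔ ℓ)} (f : I → Vect r) → Separating f → (g : Fin n → I) →
             RightInvertible (f ∘ g) → (n≤r : n ≤ r) → Completion f g n≤r
  steinitz {zero} {zero} f sep g _ _ = (λ ()) , (λ ()) , (λ ()) , (λ ()) , (λ ())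
  steinitz {zero} {suc r} f sep g _ _ =
    let i₀ , ρ , fρ≈1              = separating⇒nonzero f sep
        G , (G⁻¹ , G-inv) , fG≈e₀  = exchange (f i₀) ρ fρ≈1
        open Reduce f sep G G⁻¹ G-inv
        σ , _ , inv                = steinitz {zero} reduced reduced-separating (λ ()) ((λ _ ()) , λ ()) z≤n
    in i₀ ∷ σ , (λ ()) , lift-invertible i₀ σ fG≈e₀ inv
  steinitz {suc n} {suc r} f sep g (V , UV) (s≤s n≤r) =
    let G , (G⁻¹ , G-inv) , fG≈e₀  = exchange (f (g zero)) (λ k → V k zero) (UV zero zero)
        open Reduce f sep G G⁻¹ G-inv
        σ , σg , inv               = steinitz reduced reduced-separating (g ∘ suc)
                                       (reduced-rightInvertible g fG≈e₀ (V , UV)) n≤r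
    in g zero ∷ σ , (λ { zero → ≡.refl ; (suc i) → σg i }) , lift-invertible (g zero) σ fG≈e₀ inv

  *-cancelˡ-zero : ∀ x {a b} → x * a ≈ x * b → ¬ (a ≈ b) → x ≈ 0#
  *-cancelˡ-zero x {a} {b} xa≈xb a≉b =
    let y , eq = inverse (a - b) (λ a-b≈0 → a≉b (x∙y⁻¹≈ε⇒x≈y a b a-b≈0)) in begin
    x                    ≈⟨ *-identityʳ x ⟨
    x * 1#               ≈⟨ *-congˡ eq ⟨
    x * ((a - b) * y)    ≈⟨ *-assoc x (a - b) y ⟨
    x * (a - b) * y      ≈⟨ *-congʳ (trans (x[y-z]≈xy-xz x a b) (x≈y⇒x∙y⁻¹≈ε xa≈xb)) ⟩
    0# * y               ≈⟨ zeroˡ y ⟩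
    0#                   ∎
    where
    open SetoidReasoning setoid

  -- Simultaneous diagonalization

  -- Equal entries of d share one representative index.
  rep : ∀ {n} → Vect n → Fin n → Fin n
  rep d zero = zero
  rep d (suc t) with d (suc t) ≈? d zero
  ... | yes _ = zero
  ... | no  _ = suc (rep (d ∘ suc) t)

  rep-≈ : ∀ {n} (d : Vect n) t → d (rep d t) ≈ d t
  rep-≈ d zero = refl
  rep-≈ d (suc t) with d (suc t) ≈? d zero
  ... | yes eq = sym eq
  ... | no  _  = rep-≈ (d ∘ suc) t

  rep-≡ : ∀ {n} (d : Vect n) s t → d s ≈ d t → rep d s ≡ rep d t
  rep-≡ d zero zero eq = ≡.refl
  rep-≡ d zero (suc t) eq with d (suc t) ≈? d zero
  ... | yes _  = ≡.refl
  ... | no neq = contradiction (sym eq) neq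
  rep-≡ d (suc s) zero eq with d (suc s) ≈? d zero
  ... | yes _  = ≡.refl
  ... | no neq = contradiction eq neq
  rep-≡ d (suc s) (suc t) eq with d (suc s) ≈? d zero | d (suc t) ≈? d zero
  ... | yes _  | yes _  = ≡.refl
  ... | yes p  | no neq = contradiction (trans (sym eq) p) neq
  ... | no neq | yes p  = contradiction (trans eq p) neq
  ... | no _   | no _   = ≡.cong suc (rep-≡ (d ∘ suc) s t eq)

  diag-*-cong : ∀ {n} (d : Vect n) i j {x y} → (i ≡ j → d i * x ≈ d i * y) → diag d i j * x ≈ diag d i j * y
  diag-*-cong d i j {x} {y} eq with i ≟ j
  ... | yes i≡j = eq i≡j
  ... | no _    = trans (zeroˡ x) (sym (zeroˡ y))

  sum-𝟙 : ∀ {n} (i : Fin n) → sum (𝟙 i) ≈ 1#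
  sum-𝟙 i = trans (sum-cong-≋ (λ j → sym (*-identityʳ (𝟙 i j)))) (𝟙-▸ (λ _ → 1#) i)

  commute-cong : ∀ {n} {X X′ Y Y′ : Matrix n n} → X ≋ X′ → Y ≋ Y′ → Commute X Y → Commute X′ Y′
  commute-cong {X = X} {X′} {Y} {Y′} p q XY =
    ≋-trans (≋-sym (≋-trans (∙-congˡ X q) (∙-congʳ Y′ p)))
      (≋-trans XY (≋-trans (∙-congˡ Y p) (∙-congʳ X′ q)))

  module Conjugation {n} (P P′ : Matrix n n) (P-inv : IsInverse P P′) where
    conj-∙ : ∀ X Y → P ∙ X ∙ P′ ∙ (P ∙ Y ∙ P′) ≋ P ∙ (X ∙ Y) ∙ P′
    conj-∙ X Y = begin
      P ∙ X ∙ P′ ∙ (P ∙ Y ∙ P′)     ≈⟨ ∙-assoc (P ∙ X) P′ (P ∙ Y ∙ P′) ⟩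
      P ∙ X ∙ (P′ ∙ (P ∙ Y ∙ P′))   ≈⟨ ∙-congˡ (P ∙ X) (∙-congˡ P′ (∙-assoc P Y P′)) ⟩
      P ∙ X ∙ (P′ ∙ (P ∙ (Y ∙ P′))) ≈⟨ ∙-congˡ (P ∙ X) (cancelˡ (Y ∙ P′) (proj₂ P-inv)) ⟩
      P ∙ X ∙ (Y ∙ P′)              ≈⟨ ∙-assoc (P ∙ X) Y P′ ⟨
      P ∙ X ∙ Y ∙ P′                ≈⟨ ∙-congʳ P′ (∙-assoc P X Y) ⟩
      P ∙ (X ∙ Y) ∙ P′              ∎
      where open SetoidReasoning (≋-setoid n n)

    conj-commute : ∀ {X Y} → Commute X Y → Commute (P ∙ X ∙ P′) (P ∙ Y ∙ P′)
    conj-commute {X} {Y} XY =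
      ≋-trans (conj-∙ X Y) (≋-trans (∙-congʳ P′ (∙-congˡ P XY)) (≋-sym (conj-∙ Y X)))

    conj-undo : ∀ X → P ∙ (P′ ∙ X ∙ P) ∙ P′ ≋ X
    conj-undo X = begin
      P ∙ (P′ ∙ X ∙ P) ∙ P′    ≈⟨ ∙-congʳ P′ (∙-congˡ P (∙-assoc P′ X P)) ⟩
      P ∙ (P′ ∙ (X ∙ P)) ∙ P′  ≈⟨ ∙-congʳ P′ (cancelˡ (X ∙ P) (proj₁ P-inv)) ⟩
      X ∙ P ∙ P′               ≈⟨ cancelʳ X (proj₁ P-inv) ⟩
      X                        ∎
      where open SetoidReasoning (≋-setoid n n)

  Eigen : ∀ {n} → Matrix n n → Vect n → Set (c ⊔ ℓ)
  Eigen A x = Σ[ μ ∈ Carrier ] (∀ j → (x ◂ A) j ≈ μ * x j)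

  module Spectral {n} (A P P′ : Matrix n n) (d : Vect n) (P-inv : IsInverse P P′)
                  (A≋ : A ≋ P ∙ diag d ∙ P′) where
    open Conjugation P P′ P-inv

    -- projector s projects onto the eigenspace of d s when s is a representative and is 0 otherwise, so that the
    -- projectors sum to the identity even if d has repeated entries.
    indicator : Fin n → Vect n
    indicator s t = 𝟙 (rep d t) s

    projector : Fin n → Matrix n n
    projector s = P ∙ diag (indicator s) ∙ P′

    indicator-* : ∀ s t → indicator s t * d t ≈ indicator s t * d s
    indicator-* s t = diag-*-cong (λ _ → 1#) (rep d t) s λ where
      ≡.refl → *-congˡ (sym (rep-≈ d t))

    -- In the eigenbasis `C′` commutes with `diag d`, so C′ᵢⱼ (dᵢ - dⱼ) = 0 and `C′` links only
    -- indices at which `d` agrees. `indicator s` depends on an index only through `rep d`, hence is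
    -- constant along such links.
    projector-commutes : ∀ C → Commute C A → ∀ s → Commute C (projector s)
    projector-commutes C CA s = commute-cong (conj-undo C) (λ _ _ → refl) (conj-commute C′F≋FC′)
      where
      open Conjugation P′ P (IsInverse-sym P-inv) renaming (conj-commute to conj′-commute; conj-undo to conj′-undo)
      C′ F : Matrix n n
      C′ = P′ ∙ C ∙ P
      F = diag (indicator s)

      C′D≋DC′ : Commute C′ (diag d)
      C′D≋DC′ = commute-cong (λ _ _ → refl) (≋-trans (∙-congʳ P (∙-congˡ P′ A≋)) (conj′-undo (diag d)))
                             (conj′-commute CA)

      entrywise : ∀ i j → C′ i j * d i ≈ C′ i j * d j
      entrywise i j = begin
        C′ i j * d i          ≈⟨ *-comm _ _ ⟩
        d i * C′ i j          ≈⟨ diag-▸ d (λ k → C′ k j) i ⟨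
        (diag d ∙ C′) i j     ≈⟨ C′D≋DC′ i j ⟨
        (C′ ∙ diag d) i j     ≈⟨ ◂-diag (C′ i) d j ⟩
        C′ i j * d j          ∎
        where open SetoidReasoning setoid

      swap : ∀ i j → C′ i j * indicator s j ≈ indicator s i * C′ i j
      swap i j with d i ≈? d j
      ... | yes eq = trans (*-comm _ _) (*-congʳ (reflexive (≡.cong (λ t → 𝟙 t s) (≡.sym (rep-≡ d i j eq)))))
      ... | no neq = trans (trans (*-congʳ C′ij≈0) (zeroˡ _)) (sym (trans (*-congˡ C′ij≈0) (zeroʳ _)))
        where C′ij≈0 = *-cancelˡ-zero (C′ i j) (entrywise i j) neq

      C′F≋FC′ : Commute C′ F
      C′F≋FC′ i j = trans (◂-diag (C′ i) (indicator s) j)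
        (trans (swap i j) (sym (diag-▸ (indicator s) (λ k → C′ k j) i)))

    ◂-projector : ∀ x s j → (x ◂ projector s) j ≈ (x ◂ P ◂ diag (indicator s) ◂ P′) j
    ◂-projector x s j = trans (sym (◂-·-assoc x (P ∙ diag (indicator s)) (λ k → P′ k j)))
      (·-congʳ (λ k → P′ k j) (λ k → sym (◂-·-assoc x P (λ l → diag (indicator s) l k))))

    -- On the support of `indicator s` all entries of `d` equal `d s`, so multiplying the projector
    -- by `A` scales it by `d s`.
    projector-eigen : ∀ x s → Eigen A (x ◂ projector s)
    projector-eigen x s = d s , λ j → begin
      (x ◂ projector s ◂ A) j                   ≈⟨ ◂-·-assoc x (projector s) (λ k → A k j) ⟩
      x · (λ i → (projector s ∙ A) i j)         ≈⟨ ·-congˡ x (λ i → projector-∙ i j) ⟩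
      x · (λ i → projector s i j * d s)         ≈⟨ ·-*-assocʳ x (λ i → projector s i j) (d s) ⟩
      (x ◂ projector s) j * d s                 ≈⟨ *-comm _ _ ⟩
      d s * (x ◂ projector s) j                 ∎
      where
      open SetoidReasoning setoid
      F : Matrix n n
      F = diag (indicator s)
      projector-∙ : projector s ∙ A ≋ λ i j → projector s i j * d s
      projector-∙ i j = begin
        (projector s ∙ A) i j                    ≈⟨ ∙-congˡ (projector s) A≋ i j ⟩
        (projector s ∙ (P ∙ diag d ∙ P′)) i j    ≈⟨ conj-∙ F (diag d) i j ⟩
        (P ∙ (F ∙ diag d) ∙ P′) i j              ≈⟨ ·-congʳ (λ k → P′ k j) (λ k → trans
                                                      (·-congˡ (P i) (λ l → trans (◂-diag (F l) d k)
                                                        (diag-*-cong (indicator s) l k λ { ≡.refl → indicator-* s l })))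
                                                      (·-*-assocʳ (P i) (λ l → F l k) (d s))) ⟩
        sum (λ k → (P ∙ F) i k * d s * P′ k j)   ≈⟨ sum-cong-≋ (λ k → xy∙z≈xz∙y ((P ∙ F) i k) (d s) (P′ k j)) ⟩
        sum (λ k → (P ∙ F) i k * P′ k j * d s)   ≈⟨ *-distribʳ-sum (d s) (λ k → (P ∙ F) i k * P′ k j) ⟨
        projector s i j * d s                    ∎

    -- Each index `t` has exactly one representative, so the indicators sum to 1 at every `t`. The
    -- pairing with `w` is the form in which annihilators are tested.
    projector-decomposition : ∀ x w → x · w ≈ sum (λ s → (x ◂ projector s) · w)
    projector-decomposition x w = begin
      x · w                                             ≈⟨ ·-congˡ x (λ i → 𝟙-▸ w i) ⟨
      x · (𝟙 ▸ w)                                       ≈⟨ ·-congˡ x (λ i → ·-congʳ w (proj₁ P-inv i)) ⟨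
      x · ((P ∙ P′) ▸ w)                                ≈⟨ ·-congˡ x (λ i → ◂-·-assoc (P i) P′ w) ⟩
      x · (P ▸ z)                                       ≈⟨ ◂-·-assoc x P z ⟨
      y · z                                             ≈⟨ sum-cong-≋ (λ t → *-congʳ (trans (*-congˡ (sum-𝟙 (rep d t))) (*-identityʳ _))) ⟨
      sum (λ t → y t * sum (λ s → indicator s t) * z t) ≈⟨ sum-cong-≋ (λ t → trans (*-congʳ (*-distribˡ-sum (y t) (λ s → indicator s t)))
                                                             (*-distribʳ-sum (z t) (λ s → y t * indicator s t))) ⟩
      sum (λ t → sum (λ s → y t * indicator s t * z t)) ≈⟨ ∑-comm (λ t s → y t * indicator s t * z t) ⟩
      sum (λ s → sum (λ t → y t * indicator s t * z t)) ≈⟨ sum-cong-≋ (λ s → ·-congʳ z (λ t → ◂-diag y (indicator s) t)) ⟨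
      sum (λ s → (y ◂ diag (indicator s)) · z)          ≈⟨ sum-cong-≋ (λ s → ◂-·-assoc (y ◂ diag (indicator s)) P′ w) ⟨
      sum (λ s → (y ◂ diag (indicator s) ◂ P′) · w)     ≈⟨ sum-cong-≋ (λ s → ·-congʳ w (◂-projector x s)) ⟨
      sum (λ s → (x ◂ projector s) · w)                 ∎
      where
      open SetoidReasoning setoid
      y z : Vect n
      y = x ◂ P
      z = P′ ▸ w

  eigen-◂ : ∀ {n} (A B : Matrix n n) {x} → Commute A B → Eigen A x → Eigen A (x ◂ B)
  eigen-◂ A B {x} AB (μ , xA≈μx) = μ , λ j → begin
    (x ◂ B ◂ A) j                  ≈⟨ ◂-·-assoc x B (λ k → A k j) ⟩
    x · (λ i → (B ∙ A) i j)        ≈⟨ ·-congˡ x (λ i → AB i j) ⟨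
    x · (λ i → (A ∙ B) i j)        ≈⟨ ◂-·-assoc x A (λ k → B k j) ⟨
    (x ◂ A ◂ B) j                  ≈⟨ sum-cong-≋ (λ i → trans (*-congʳ (xA≈μx i)) (*-assoc μ (x i) (B i j))) ⟩
    sum (λ i → μ * (x i * B i j))  ≈⟨ *-distribˡ-sum μ (λ i → x i * B i j) ⟨
    μ * (x ◂ B) j                  ∎
    where open SetoidReasoning setoid

  JointEigen : ∀ {n p} → (Fin p → Matrix n n) → Vect n → Set (c ⊔ ℓ)
  JointEigen A x = ∀ k → Eigen (A k) x

  -- Induction on the number of matrices. A joint eigenvector of all but the first splits into its
  -- projections onto the eigenspaces of the first. These remain eigenvectors of the others because
  -- the projectors commute with them, so `w` kills every summand. With no matrices left, every
  -- vector is a joint eigenvector.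
  jointEigen-annihilator : ∀ {n p} (A : Fin p → Matrix n n) →
                           (∀ k l → Commute (A k) (A l)) → (∀ k → Diagonalizable (A k)) →
                           ∀ w → (∀ x → JointEigen A x → x · w ≈ 0#) → ∀ x → x · w ≈ 0#
  jointEigen-annihilator {p = zero} A comm diags w ann x = ann x λ ()
  jointEigen-annihilator {p = suc p} A comm diags w ann =
    jointEigen-annihilator (A ∘ suc) (λ k l → comm (suc k) (suc l)) (diags ∘ suc) w λ x eig →
      trans (projector-decomposition x w) (sum-zero (λ s → ann (x ◂ projector s) λ where
        zero    → projector-eigen x s
        (suc k) → eigen-◂ (A (suc k)) (projector s) (projector-commutes (A (suc k)) (comm (suc k) zero) s) (eig k)))
    where
    P P′ : Matrix _ _
    P = proj₁ (diags zero)
    P′ = proj₁ (proj₂ (diags zero))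
    d : Vect _
    d = proj₁ (proj₂ (proj₂ (diags zero)))
    eqs : IsInverse P P′ × A zero ≋ P ∙ diag d ∙ P′
    eqs = proj₂ (proj₂ (proj₂ (diags zero)))
    open Spectral (A zero) P P′ d (proj₁ eqs) (proj₂ eqs)

  -- `steinitz` is applied to the family of all joint eigenvectors with nothing prescribed. The
  -- family separates because an annihilator of it pairs to zero with every coordinate vector. The
  -- chosen vectors are the rows of `P`.
  simultaneously-diagonalizable :
    ∀ {n p} (A : Fin p → Matrix n n) → (∀ k l → Commute (A k) (A l)) → (∀ k → Diagonalizable (A k)) →
    Σ[ P ∈ Matrix n n ] Invertible P × Σ[ D ∈ (Fin p → Vect n) ] (∀ k → P ∙ A k ≋ diag (D k) ∙ P)
  simultaneously-diagonalizable {n} A comm diags =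
    let σ , _ , inv = steinitz (proj₁ {B = JointEigen A}) separating (λ ()) ((λ _ ()) , λ ()) z≤n
    in proj₁ ∘ σ , inv , (λ k i → proj₁ (proj₂ (σ i) k)) , λ k i j →
         trans (proj₂ (proj₂ (σ i) k) j) (sym (diag-▸ (λ i → proj₁ (proj₂ (σ i) k)) (λ i → proj₁ (σ i) j) i))
    where
    separating : Separating (proj₁ {B = JointEigen A})
    separating w ann j = trans (sym (𝟙-▸ w j))
      (jointEigen-annihilator A comm diags w (λ x eig → ann (x , eig)) (𝟙 j))

  -- Generic linear combinations

  ×-1-distinct : ∀ {m n} → m < n → ¬ (m ×ₘ 1# ≈ n ×ₘ 1#)
  ×-1-distinct {m} {n} m<n eq =
    -- `m < n` is `suc m ≤ n`, so the gap between `m` and `n` is the positive number `suc o`, in the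
    -- form that `char0` expects.
    let o , 1+m+o≡n = m≤n⇒∃[o]m+o≡n m<n in
    char0 o (+-identityʳ-unique (m ×ₘ 1#) (suc o ×ₘ 1#) (begin
      m ×ₘ 1# + suc o ×ₘ 1#  ≈⟨ ×-homo-+ 1# m (suc o) ⟨
      (m ℕ.+ suc o) ×ₘ 1#    ≈⟨ ×-congˡ (≡.trans (+-suc m o) 1+m+o≡n) ⟩
      n ×ₘ 1#                ≈⟨ eq ⟨
      m ×ₘ 1#                ∎))
    where open SetoidReasoning setoid

  -- Each affine form t * α s + β s with α s ≉ 0 vanishes at only one t, so one of the r + 1
  -- values t = 0, …, r avoids all r zeros.
  avoid-zeros : ∀ {r} (α β : Vect r) → ∃[ t ] (∀ s → t * α s + β s ≈ 0# → α s ≈ 0#)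
  avoid-zeros {r} α β
    with any? {n = suc r} (λ t → all? (λ s → ((toℕ t ×ₘ 1#) * α s + β s ≈? 0#) →-dec (α s ≈? 0#)))
  ... | yes (t , good) = toℕ t ×ₘ 1# , good
  ... | no none = contradiction (*-cancelˡ-zero (α s) αi≈αj (×-1-distinct i<j)) α≉0
    where
    value : Fin (suc r) → Fin r → Carrier
    value t s = (toℕ t ×ₘ 1#) * α s + β s

    bad : ∀ t → ∃[ s ] ¬ (value t s ≈ 0# → α s ≈ 0#)
    bad t = ¬∀⟶∃¬ r _ (λ s → (value t s ≈? 0#) →-dec (α s ≈? 0#)) (λ good → none (t , good))

    value≈0 : ∀ t → value t (proj₁ (bad t)) ≈ 0#
    value≈0 t = decidable-stable (value t (proj₁ (bad t)) ≈? 0#) (λ ≉0 → proj₂ (bad t) (λ ≈0 → contradiction ≈0 ≉0))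

    collision = pigeonhole (n<1+n r) (proj₁ ∘ bad)
    i j : Fin (suc r)
    i = proj₁ collision
    j = proj₁ (proj₂ collision)
    i<j = proj₁ (proj₂ (proj₂ collision))
    s : Fin r
    s = proj₁ (bad i)
    eqᵢ : value i s ≈ 0#
    eqᵢ = value≈0 i
    eqⱼ : value j s ≈ 0#
    eqⱼ = ≡.subst (λ s → value j s ≈ 0#) (≡.sym (proj₂ (proj₂ (proj₂ collision)))) (value≈0 j)
    αi≈αj : α s * (toℕ i ×ₘ 1#) ≈ α s * (toℕ j ×ₘ 1#)
    αi≈αj = trans (*-comm _ _) (trans (+-cancelʳ (β s) _ _ (trans eqᵢ (sym eqⱼ))) (*-comm _ _))
    α≉0 : ¬ (α s ≈ 0#)
    α≉0 α≈0 = proj₂ (bad i) (λ _ → α≈0)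

  -- Induction on `p`: `a` is generic for the tails, then `t` is chosen by `avoid-zeros`. If a
  -- pairing still vanished, the head of `w s` would be zero; its tail would then be nonzero and
  -- pair to zero with `a`, a contradiction.
  generic-vector : ∀ {p r} (w : Fin r → Vect p) → Σ[ a ∈ Vect p ] (∀ s → NonZeroVect (w s) → ¬ (a · w s ≈ 0#))
  generic-vector {zero}  w = (λ ()) , λ s w≉0 _ → w≉0 (λ ())
  generic-vector {suc p} w =
    let a , a-generic = generic-vector (λ s → w s ∘ suc)
        t , t-avoids  = avoid-zeros (λ s → w s zero) (λ s → a · (w s ∘ suc))
    in t ∷ a , λ s w≉0 aw≈0 →
      let w₀≈0 = t-avoids s aw≈0 in
      a-generic s
        (λ tail≈0 → w≉0 λ { zero → w₀≈0 ; (suc k) → tail≈0 k })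
        (trans (sym (trans (+-congʳ (trans (*-congˡ w₀≈0) (zeroʳ t))) (+-identityˡ _))) aw≈0)

  -- Tensors given by triads

  triads : ∀ {m n p r} → Matrix m r → Matrix r n → Matrix r p → Tensor m n p
  triads P Q w i j k = sum (λ s → P i s * Q s j * w s k)

  slice-triads : ∀ {m n p r} (P : Matrix m r) (Q : Matrix r n) (w : Matrix r p) k →
                 slice (triads P Q w) k ≋ P ∙ diag (λ s → w s k) ∙ Q
  slice-triads P Q w k i j = sum-cong-≋ (λ s →
    trans (xy∙z≈xz∙y (P i s) (Q s j) (w s k)) (*-congʳ (sym (◂-diag (P i) (λ s → w s k) s))))

  span-triads : ∀ {m n p r} (P : Matrix m r) (Q : Matrix r n) (w : Matrix r p) (a : Vect p) →
                (λ i j → sum (λ k → a k * triads P Q w i j k)) ≋ P ∙ diag (λ s → a · w s) ∙ Q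
  span-triads P Q w a i j = begin
    sum (λ k → a k * sum (λ s → P i s * Q s j * w s k))    ≈⟨ sum-cong-≋ (λ k → *-distribˡ-sum (a k) (λ s → P i s * Q s j * w s k)) ⟩
    sum (λ k → sum (λ s → a k * (P i s * Q s j * w s k)))  ≈⟨ ∑-comm (λ k s → a k * (P i s * Q s j * w s k)) ⟩
    sum (λ s → sum (λ k → a k * (P i s * Q s j * w s k)))  ≈⟨ sum-cong-≋ (λ s → sum-cong-≋ (λ k → x∙yz≈y∙xz (a k) (P i s * Q s j) (w s k))) ⟩
    sum (λ s → sum (λ k → P i s * Q s j * (a k * w s k)))  ≈⟨ sum-cong-≋ (λ s → *-distribˡ-sum (P i s * Q s j) (λ k → a k * w s k)) ⟨
    -- This sum is the only slice of the triads whose third factors are the scalars a · w s, so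
    -- `slice-triads` applies with p = 1.
    sum (λ s → P i s * Q s j * (a · w s))                  ≈⟨ slice-triads P Q (λ s _ → a · w s) (zero {0}) i j ⟩
    (P ∙ diag (λ s → a · w s) ∙ Q) i j                     ∎
    where open SetoidReasoning setoid

  -- `steinitz` for the family of all vectors, which separates through the coordinate vectors.
  -- `Lift` places this family in the universe required of `I`.
  complete : ∀ {n r} (U : Matrix n r) → RightInvertible U → (n≤r : n ≤ r) →
             Σ[ P ∈ Matrix r r ] Invertible P × (∀ i → P (inject≤ i n≤r) ≡ U i)
  complete {n} {r} U U-inv n≤r =
    let σ , σ-U , inv = steinitz {I = Lift (c ⊔ ℓ) (Vect r)} lower
          (λ w ann j → trans (sym (𝟙-▸ w j)) (ann (lift (𝟙 j)))) (lift ∘ U) U-inv n≤r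
    in lower ∘ σ , inv , λ i → ≡.cong lower (σ-U i)

  diag-∙ : ∀ {n} (d e : Vect n) → diag d ∙ diag e ≋ diag (λ i → d i * e i)
  diag-∙ d e i j = trans (diag-▸ d (λ k → diag e k j) i) (entry i j)
    where
    entry : ∀ i j → d i * diag e i j ≈ diag (λ i → d i * e i) i j
    entry i j with i ≟ j
    ... | yes _ = refl
    ... | no _  = zeroʳ (d i)

  diag-cong : ∀ {n} {d e : Vect n} → (∀ i → d i ≈ e i) → diag d ≋ diag e
  diag-cong d≈e i j with i ≟ j
  ... | yes _ = d≈e i
  ... | no _  = refl

  diag-isInverse : ∀ {n} (d e : Vect n) → (∀ i → d i * e i ≈ 1#) → IsInverse (diag d) (diag e)
  diag-isInverse d e de≈1 = ≋-trans (diag-∙ d e) (diag-cong de≈1)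
                          , ≋-trans (diag-∙ e d) (diag-cong (λ i → trans (*-comm _ _) (de≈1 i)))

  diag-commute : ∀ {n} (d e : Vect n) → Commute (diag d) (diag e)
  diag-commute d e = ≋-trans (diag-∙ d e) (≋-trans (diag-cong (λ i → *-comm (d i) (e i))) (≋-sym (diag-∙ e d)))

  inverse-unique : ∀ {n} {A B B′ : Matrix n n} → IsInverse A B → IsInverse A B′ → B ≋ B′
  inverse-unique {A = A} {B} {B′} (AB , _) (_ , B′A) =
    ≋-trans (≋-sym (cancelˡ B B′A)) (≋-trans (∙-congˡ B′ AB) (∙-identityʳ B′))

  module _ {r p} (P P⁻¹ Q Q⁻¹ : Matrix r r) (P-inv : IsInverse P P⁻¹) (Q-inv : IsInverse Q Q⁻¹) (w : Matrix r p) where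
    private
      S : Tensor r r p
      S = triads P Q w

    -- For a generic combination of the slices every a · w s is nonzero, which makes the diagonal
    -- factor invertible.
    triads-span : (∀ s → NonZeroVect (w s)) → SpanHasInvertible (slice S)
    triads-span w≉0 =
      let a , a-generic = generic-vector w
          e             = λ s → proj₁ (inverse (a · w s) (a-generic s (w≉0 s)))
          d-inv         = diag-isInverse (λ s → a · w s) e (λ s → proj₂ (inverse (a · w s) (a-generic s (w≉0 s))))
      in P ∙ diag (λ s → a · w s) ∙ Q , (a , ≋-sym (span-triads P Q w a))
       , _ , ∙-isInverse (∙-isInverse P-inv d-inv) Q-inv

    module _ (Z Z⁻¹ : Matrix r r) (Z∈ : Z ∈Span slice S) (Z-inv : IsInverse Z Z⁻¹) where
      private
        d e : Vect r
        d s = proj₁ Z∈ · w s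

        Z≋ : Z ≋ P ∙ diag d ∙ Q
        Z≋ = ≋-trans (proj₂ Z∈) (span-triads P Q w (proj₁ Z∈))

        -- Since Z = P D Q with D = `diag d`, the inverse of D has to be Q Z⁻¹ P. The diagonal of
        -- this matrix directly supplies inverses for the entries of `d`.
        E : Matrix r r
        E = Q ∙ (Z⁻¹ ∙ P)

        e s = E s s

        dE : diag d ∙ E ≋ 𝟙
        dE = begin
          diag d ∙ (Q ∙ (Z⁻¹ ∙ P))                   ≈⟨ ∙-assoc (diag d) Q (Z⁻¹ ∙ P) ⟨
          diag d ∙ Q ∙ (Z⁻¹ ∙ P)                     ≈⟨ ∙-congʳ (Z⁻¹ ∙ P) (cancelˡ (diag d ∙ Q) (proj₂ P-inv)) ⟨
          P⁻¹ ∙ (P ∙ (diag d ∙ Q)) ∙ (Z⁻¹ ∙ P)       ≈⟨ ∙-congʳ (Z⁻¹ ∙ P) (∙-congˡ P⁻¹ (≋-trans Z≋ (∙-assoc P (diag d) Q))) ⟨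
          P⁻¹ ∙ Z ∙ (Z⁻¹ ∙ P)                        ≈⟨ proj₁ (∙-isInverse (IsInverse-sym P-inv) Z-inv) ⟩
          𝟙                                          ∎
          where open SetoidReasoning (≋-setoid r r)

        d-inv : IsInverse (diag d) (diag e)
        d-inv = diag-isInverse d e (λ s → trans (sym (diag-▸ d (λ t → E t s) s)) (trans (dE s s) (𝟙-diagonal s)))

        Z⁻¹≋ : Z⁻¹ ≋ Q⁻¹ ∙ (diag e ∙ P⁻¹)
        Z⁻¹≋ = inverse-unique Z-inv (IsInverse-respˡ (≋-sym Z≋) (∙-isInverse (∙-isInverse P-inv d-inv) Q-inv))

        eigenvalues : Fin p → Vect r
        eigenvalues k s = e s * w s k

        Z⁻¹∙slice : ∀ k → Z⁻¹ ∙ slice S k ≋ Q⁻¹ ∙ diag (eigenvalues k) ∙ Q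
        Z⁻¹∙slice k = begin
          Z⁻¹ ∙ slice S k                               ≈⟨ ∙-congʳ (slice S k) Z⁻¹≋ ⟩
          Q⁻¹ ∙ (diag e ∙ P⁻¹) ∙ slice S k              ≈⟨ ∙-congˡ (Q⁻¹ ∙ (diag e ∙ P⁻¹)) (≋-trans (slice-triads P Q w k) (∙-assoc P W Q)) ⟩
          Q⁻¹ ∙ (diag e ∙ P⁻¹) ∙ (P ∙ (W ∙ Q))          ≈⟨ ∙-assoc Q⁻¹ (diag e ∙ P⁻¹) (P ∙ (W ∙ Q)) ⟩
          Q⁻¹ ∙ (diag e ∙ P⁻¹ ∙ (P ∙ (W ∙ Q)))          ≈⟨ ∙-congˡ Q⁻¹ (≋-trans (∙-assoc (diag e) P⁻¹ (P ∙ (W ∙ Q))) (∙-congˡ (diag e) (cancelˡ (W ∙ Q) (proj₂ P-inv)))) ⟩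
          Q⁻¹ ∙ (diag e ∙ (W ∙ Q))                      ≈⟨ ∙-congˡ Q⁻¹ (∙-assoc (diag e) W Q) ⟨
          Q⁻¹ ∙ (diag e ∙ W ∙ Q)                        ≈⟨ ∙-congˡ Q⁻¹ (∙-congʳ Q (diag-∙ e (λ s → w s k))) ⟩
          Q⁻¹ ∙ (diag (eigenvalues k) ∙ Q)              ≈⟨ ∙-assoc Q⁻¹ (diag (eigenvalues k)) Q ⟨
          Q⁻¹ ∙ diag (eigenvalues k) ∙ Q                ∎
          where
          open SetoidReasoning (≋-setoid r r)
          W : Matrix r r
          W = diag (λ s → w s k)

      triads-commute : ∀ k l → Commute (Z⁻¹ ∙ slice S k) (Z⁻¹ ∙ slice S l)
      triads-commute k l = commute-cong (≋-sym (Z⁻¹∙slice k)) (≋-sym (Z⁻¹∙slice l))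
        (Conjugation.conj-commute Q⁻¹ Q (IsInverse-sym Q-inv) (diag-commute (eigenvalues k) (eigenvalues l)))

      triads-diagonalizable : ∀ k → Diagonalizable (Z⁻¹ ∙ slice S k)
      triads-diagonalizable k = Q⁻¹ , Q , eigenvalues k , IsInverse-sym Q-inv , Z⁻¹∙slice k

  -- Rank and sums of triads

  least : ∀ (P : ℕ → Set (c ⊔ ℓ)) n → P n → Σ[ m ∈ ℕ ] (P m × (∀ k → P k → m ≤ k))
  least P zero    p = zero , p , λ _ _ → z≤n
  least P (suc n) p with em {P zero}
  ... | yes p₀ = zero , p₀ , λ _ _ → z≤n
  ... | no ¬p₀ = let m , pm , m-least = least (P ∘ suc) n p in
    suc m , pm , λ { zero p₀ → contradiction p₀ ¬p₀ ; (suc k) pk → s≤s (m-least k pk) }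

  -- `Rank≤` asks for an attained minimum; `least` extracts one from the given decomposition by
  -- excluded middle.
  sumOfRankOnes⇒rank≤ : ∀ {m n p r s} {T : Tensor m n p} → SumOfRankOnes T s → s ≤ r → Rank≤ T r
  sumOfRankOnes⇒rank≤ {s = s} {T} sum s≤r =
    let q , sum-q , q-least = least (SumOfRankOnes T) s sum in q , (sum-q , q-least) , ≤-trans (q-least s sum) s≤r

  sumOfRankOnes-cong : ∀ {m n p s} {T T′ : Tensor m n p} → T ≋ₜ T′ → SumOfRankOnes T′ s → SumOfRankOnes T s
  sumOfRankOnes-cong T≋T′ (X , ones , T′≋) = X , ones , λ i j k → trans (T≋T′ i j k) (T′≋ i j k)

  -- A triad with a zero factor contributes nothing and is dropped, which is why `s` can fall below
  -- `r`.
  triads⇒sumOfRankOnes : ∀ {m n p} r (u : Matrix r m) (v : Matrix r n) (w : Matrix r p) →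
                         ∃[ s ] (s ≤ r × SumOfRankOnes (triads (u ᵀ) v w) s)
  triads⇒sumOfRankOnes zero u v w = zero , z≤n , (λ ()) , (λ ()) , λ _ _ _ → refl
  triads⇒sumOfRankOnes {m} {n} {p} (suc r) u v w
    with triads⇒sumOfRankOnes r (u ∘ suc) (v ∘ suc) (w ∘ suc)
  ... | s , s≤r , X , ones , tail≋
    with all? (λ i → u zero i ≈? 0#) | all? (λ j → v zero j ≈? 0#) | all? (λ k → w zero k ≈? 0#)
  ... | yes u≈0 | _ | _ = s , m≤n⇒m≤1+n s≤r , X , ones , λ i j k →
    trans (+-congʳ (trans (*-congʳ (trans (*-congʳ (u≈0 i)) (zeroˡ _))) (zeroˡ _))) (trans (+-identityˡ _) (tail≋ i j k))
  ... | no _ | yes v≈0 | _ = s , m≤n⇒m≤1+n s≤r , X , ones , λ i j k →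
    trans (+-congʳ (trans (*-congʳ (trans (*-congˡ (v≈0 j)) (zeroʳ _))) (zeroˡ _))) (trans (+-identityˡ _) (tail≋ i j k))
  ... | no _ | no _ | yes w≈0 = s , m≤n⇒m≤1+n s≤r , X , ones , λ i j k →
    trans (+-congʳ (trans (*-congˡ (w≈0 k)) (zeroʳ _))) (trans (+-identityˡ _) (tail≋ i j k))
  ... | no u≉0 | no v≉0 | no w≉0 = suc s , s≤s s≤r , (u zero ⊗ v zero ⊗ w zero) ∷ X
    , (λ { zero → u zero , v zero , w zero , u≉0 , v≉0 , w≉0 , (λ _ _ _ → refl) ; (suc t) → ones t })
    , λ i j k → +-congˡ (tail≋ i j k)

  -- Only the third factors are required to be nonzero: padding by 0 ⊗ 0 ⊗ e₀ keeps the tensor, while a generic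
  -- combination of the third factors still has no zero entry.
  NonDegenerateTriads : ∀ {m n p} → Tensor m n p → ℕ → Set (c ⊔ ℓ)
  NonDegenerateTriads {m} {n} {p} T r = Σ[ u ∈ Matrix r m ] Σ[ v ∈ Matrix r n ] Σ[ w ∈ Matrix r p ]
    ((∀ s → NonZeroVect (w s)) × T ≋ₜ triads (u ᵀ) v w)

  pad : ∀ {m n p r s} .{{_ : NonZero p}} {T : Tensor m n p} → s ≤′ r → NonDegenerateTriads T s → NonDegenerateTriads T r
  pad ≤′-refl triads = triads
  pad {p = suc p} (≤′-step s≤r) triads =
    let u , v , w , w≉0 , T≋ = pad s≤r triads in
    (λ _ → 0#) ∷ u , (λ _ → 0#) ∷ v , 𝟙 zero ∷ w ,
    (λ { zero e≈0 → 1≉0 (e≈0 zero) ; (suc s) → w≉0 s }) ,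
    λ i j k → trans (T≋ i j k) (sym (trans (+-congʳ (trans (*-congʳ (zeroˡ 0#)) (zeroˡ _))) (+-identityˡ _)))

  rank≤⇒triads : ∀ {m n p r} .{{_ : NonZero p}} {T : Tensor m n p} → Rank≤ T r → NonDegenerateTriads T r
  rank≤⇒triads (s , ((X , ones , T≋) , _) , s≤r) = pad (≤⇒≤′ s≤r)
    ( (λ t → proj₁ (ones t))
    , (λ t → proj₁ (proj₂ (ones t)))
    , (λ t → proj₁ (proj₂ (proj₂ (ones t))))
    , (λ t → proj₁ (proj₂ (proj₂ (proj₂ (proj₂ (proj₂ (ones t)))))) )
    , λ i j k → trans (T≋ i j k) (sum-cong-≋ (λ t → proj₂ (proj₂ (proj₂ (proj₂ (proj₂ (proj₂ (ones t)))))) i j k)))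

  -- The two implications

  IsDiagonalizableExtension : ∀ {n p r} → n ≤ r → Tensor n n p → Tensor r r p → Set (c ⊔ ℓ)
  IsDiagonalizableExtension {n} {p} {r} n≤r T S = SpanHasInvertible (slice S)
    × (∀ (Z Z⁻¹ : Matrix r r) → Z ∈Span slice S → IsInverse Z Z⁻¹ →
         (∀ (i j : Fin p) → Commute (Z⁻¹ ∙ slice S i) (Z⁻¹ ∙ slice S j))
         × (∀ (i : Fin p) → Diagonalizable (Z⁻¹ ∙ slice S i)))
    × Subtensor n≤r T S

  rank≤⇒extension : ∀ {n p r} .{{_ : NonZero p}} (T : Tensor n n p) →
                    SpanHasInvertible (slice T) → (n≤r : n ≤ r) →
                    Rank≤ T r → Σ[ S ∈ Tensor r r p ] IsDiagonalizableExtension n≤r T S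
  rank≤⇒extension {n} {p} {r} T (A , (a , A≋) , B , AB , BA) n≤r rank≤ =
    let P , (P⁻¹ , P-inv) , P-U = complete (u ᵀ) U-inv n≤r
        Q , (Q⁻¹ , Q-inv) , Q-V = complete (v ᵀ) V-inv n≤r
    -- `complete` adds rows, whereas `v` has to be extended by columns; so `v ᵀ` is completed and
    -- `Q` is transposed back.
    in triads P (Q ᵀ) w
     , triads-span P P⁻¹ (Q ᵀ) (Q⁻¹ ᵀ) P-inv (ᵀ-isInverse Q-inv) w w≉0
     , (λ Z Z⁻¹ Z∈ Z-inv → triads-commute P P⁻¹ (Q ᵀ) (Q⁻¹ ᵀ) P-inv (ᵀ-isInverse Q-inv) w Z Z⁻¹ Z∈ Z-inv
                         , triads-diagonalizable P P⁻¹ (Q ᵀ) (Q⁻¹ ᵀ) P-inv (ᵀ-isInverse Q-inv) w Z Z⁻¹ Z∈ Z-inv)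
     , λ i j k → trans (T≋ i j k) (sum-cong-≋ (λ s → *-congʳ (*-cong
         (reflexive (≡.cong (λ x → x s) (≡.sym (P-U i)))) (reflexive (≡.cong (λ x → x s) (≡.sym (Q-V j)))))))
    where
    nonDegenerate = rank≤⇒triads {T = T} rank≤
    u v : Matrix r n
    u = proj₁ nonDegenerate
    v = proj₁ (proj₂ nonDegenerate)
    w : Matrix r p
    w = proj₁ (proj₂ (proj₂ nonDegenerate))
    w≉0 = proj₁ (proj₂ (proj₂ (proj₂ nonDegenerate)))
    T≋ : T ≋ₜ triads (u ᵀ) v w
    T≋ = proj₂ (proj₂ (proj₂ (proj₂ nonDegenerate)))
    Δ : Matrix r r
    Δ = diag (λ s → a · w s)
    A≋UΔV : A ≋ u ᵀ ∙ Δ ∙ v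
    A≋UΔV = ≋-trans A≋ (≋-trans (λ i j → sum-cong-≋ (λ k → *-congˡ (T≋ i j k))) (span-triads (u ᵀ) v w a))
    -- As A = U Δ V, the equation A B = 1 exhibits Δ V B as a right inverse of U. Transposing B A =
    -- 1 treats V in the same way.
    U-inv : RightInvertible (u ᵀ)
    U-inv = Δ ∙ (v ∙ B) , (begin
      u ᵀ ∙ (Δ ∙ (v ∙ B))  ≈⟨ ∙-assoc (u ᵀ) Δ (v ∙ B) ⟨
      u ᵀ ∙ Δ ∙ (v ∙ B)    ≈⟨ ∙-assoc (u ᵀ ∙ Δ) v B ⟨
      u ᵀ ∙ Δ ∙ v ∙ B      ≈⟨ ∙-congʳ B A≋UΔV ⟨
      A ∙ B                ≈⟨ AB ⟩
      𝟙                    ∎)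
      where open SetoidReasoning (≋-setoid n n)
    V-inv : RightInvertible (v ᵀ)
    V-inv = (B ∙ (u ᵀ ∙ Δ)) ᵀ , (begin
      v ᵀ ∙ (B ∙ (u ᵀ ∙ Δ)) ᵀ  ≈⟨ ᵀ-∙ (B ∙ (u ᵀ ∙ Δ)) v ⟨
      (B ∙ (u ᵀ ∙ Δ) ∙ v) ᵀ    ≈⟨ (λ i j → ∙-assoc B (u ᵀ ∙ Δ) v j i) ⟩
      (B ∙ (u ᵀ ∙ Δ ∙ v)) ᵀ    ≈⟨ (λ i j → ∙-congˡ B A≋UΔV j i) ⟨
      (B ∙ A) ᵀ                ≈⟨ (λ i j → trans (BA j i) (𝟙-sym j i)) ⟩
      𝟙                        ∎)
      where open SetoidReasoning (≋-setoid n n)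

  extension⇒rank≤ : ∀ {n p r} (T : Tensor n n p) (n≤r : n ≤ r) →
                    Σ[ S ∈ Tensor r r p ] IsDiagonalizableExtension n≤r T S → Rank≤ T r
  extension⇒rank≤ {n} {p} {r} T n≤r (S , (Z , Z∈ , Z⁻¹ , Z-inv) , diagonalizes , T⊂S) =
    let q , q≤r , ones = triads⇒sumOfRankOnes r u v w in
    sumOfRankOnes⇒rank≤ (sumOfRankOnes-cong T≋ ones) q≤r
    where
    A : Fin p → Matrix r r
    A k = Z⁻¹ ∙ slice S k
    diagonalization = simultaneously-diagonalizable A
      (proj₁ (diagonalizes Z Z⁻¹ Z∈ Z-inv)) (proj₂ (diagonalizes Z Z⁻¹ Z∈ Z-inv))
    P P⁻¹ : Matrix r r
    P = proj₁ diagonalization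
    P⁻¹ = proj₁ (proj₁ (proj₂ diagonalization))
    P-inv : IsInverse P P⁻¹
    P-inv = proj₂ (proj₁ (proj₂ diagonalization))
    D : Fin p → Vect r
    D = proj₁ (proj₂ (proj₂ diagonalization))
    PA≋DP : ∀ k → P ∙ A k ≋ diag (D k) ∙ P
    PA≋DP = proj₂ (proj₂ (proj₂ diagonalization))
    w : Matrix r p
    w s k = D k s
    S≋ : S ≋ₜ triads (Z ∙ P⁻¹) P w
    S≋ i j k = (begin
      slice S k                        ≈⟨ cancelˡ (slice S k) (proj₁ Z-inv) ⟨
      Z ∙ A k                          ≈⟨ ∙-congˡ Z (cancelˡ (A k) (proj₂ P-inv)) ⟨
      Z ∙ (P⁻¹ ∙ (P ∙ A k))            ≈⟨ ∙-congˡ Z (∙-congˡ P⁻¹ (PA≋DP k)) ⟩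
      Z ∙ (P⁻¹ ∙ (diag (D k) ∙ P))     ≈⟨ ∙-assoc Z P⁻¹ (diag (D k) ∙ P) ⟨
      Z ∙ P⁻¹ ∙ (diag (D k) ∙ P)       ≈⟨ ∙-assoc (Z ∙ P⁻¹) (diag (D k)) P ⟨
      Z ∙ P⁻¹ ∙ diag (D k) ∙ P         ≈⟨ slice-triads (Z ∙ P⁻¹) P w k ⟨
      slice (triads (Z ∙ P⁻¹) P w) k   ∎) i j
      where open SetoidReasoning (≋-setoid r r)
    -- Restriction to the first `n` rows and columns truncates the first two factors of each triad
    -- and keeps the number of triads.
    u v : Matrix r n
    u s i = (Z ∙ P⁻¹) (inject≤ i n≤r) s
    v s j = P s (inject≤ j n≤r)
    T≋ : T ≋ₜ triads (u ᵀ) v w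
    T≋ i j k = trans (T⊂S i j k) (S≋ (inject≤ i n≤r) (inject≤ j n≤r) k)

-- Characteristic zero for ℂ and its subfields

private
  module ℂ = CommutativeRing ℂ-commutativeRing
open MonoidMult ℂ.+-monoid using () renaming (_×_ to _×ₘ_)

n×1-nonNegative : ∀ n k → 0ℚ ℚ.≤ seq (re (n ×ₘ ℂ.1#)) k
n×1-nonNegative zero k = ℚ.≤-refl
n×1-nonNegative (suc n) k = ℚ.+-mono-≤ (ℚ.nonNegative⁻¹ 1ℚ) (n×1-nonNegative n k)

1≤1+n×1 : ∀ n k → 1ℚ ℚ.≤ seq (re (suc n ×ₘ ℂ.1#)) k
1≤1+n×1 n k = ℚ.+-mono-≤ (ℚ.≤-refl {1ℚ}) (n×1-nonNegative n k)

-- Every term of the rational sequence of the real part is at least 1, so it never comes within ε =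
-- 1 of the zero sequence.
ℂ-characteristicZero : ∀ n → ¬ (suc n ×ₘ ℂ.1# ℂ.≈ ℂ.0#)
ℂ-characteristicZero n (mk≈ᵢ (mk≈ x≈0) _) =
  let N , small = x≈0 1ℚ (ℚ.positive⁻¹ 1ℚ)
      x = seq (re (suc n ×ₘ ℂ.1#)) N
      1≤∣x-0∣ = ≡.subst (λ y → 1ℚ ℚ.≤ ℚ.∣ y ∣) (≡.sym (ℚ.+-identityʳ x))
        (ℚ.≤-trans (1≤1+n×1 n N) (ℚ.≤-reflexive (≡.sym (ℚ.0≤p⇒∣p∣≡p (n×1-nonNegative (suc n) N)))))
  in ℚ.<-irrefl ≡.refl (ℚ.≤-<-trans 1≤∣x-0∣ (small N ≤-refl))

-- Addition and the unit of `K` are by definition those of ℂ, so positive multiples of 1 stay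
-- nonzero in `K`.
subfield-multiple : ∀ {ℓ} (K : Subfield ℓ) n → let open CommutativeRing (Subfield.commutativeRing K) in
                    proj₁ (MonoidMult._×_ +-monoid n 1#) ≡ n ×ₘ ℂ.1#
subfield-multiple K zero    = ≡.refl
subfield-multiple K (suc n) = ≡.cong (ℂ.1# ℂ.+_) (subfield-multiple K n)

subfield-isField : ∀ {ℓ} (K : Subfield ℓ) → IsFieldOfCharacteristicZero (Subfield.commutativeRing K)
subfield-isField K = record
  { inverse = λ (x , x∈K) x≉0 → let y , y∈K , xy≈1 = Subfield.inv-closed K x∈K x≉0 in (y , y∈K) , xy≈1
  ; char0   = λ n → ≡.subst (λ x → ¬ (x ℂ.≈ ℂ.0#)) (≡.sym (subfield-multiple K (suc n))) (ℂ-characteristicZero n)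
  }

theorem4 : ∀ {ℓ : Level} → ExcludedMiddle ℓ →
    (K : Subfield ℓ) → let open LinearAlgebra (Subfield.commutativeRing K) in
    ∀ (n p : ℕ) .{{_ : NonZero p}} (T : Tensor n n p) →
    SpanHasInvertible (slice T) →
    ∀ (r : ℕ) (n≤r : n ≤ r) →
    Rank≤ T r ⇔
    (Σ[ S ∈ Tensor r r p ] (SpanHasInvertible (slice S)
    × (∀ (Z Z⁻¹ : Matrix r r) → Z ∈Span slice S → IsInverse Z Z⁻¹ →
    (∀ (i j : Fin p) → Commute (Z⁻¹ ∙ slice S i) (Z⁻¹ ∙ slice S j))
    × (∀ (i : Fin p) → Diagonalizable (Z⁻¹ ∙ slice S i)))
    × Subtensor n≤r T S))
-- `IsDiagonalizableExtension` unfolds to the conjunction in the statement, so both implications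
-- apply as they stand.
theorem4 em K n p T T-inv r n≤r = mk⇔ (rank≤⇒extension T T-inv n≤r) (extension⇒rank≤ T n≤r)
  where open ClassicalField (Subfield.commutativeRing K) (subfield-isField K) em
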